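{- Let $n\geq3$. Then the number $p_n$ of inequivalent integer polygons with perimeter $n$ is \[ p_n = \sum_{d\mid n}\frac{\varphi(d)\cdot2^{n/d-1}}n + 2^{\lfloor (n-3)/2\rfloor} - \begin{cases} 3\cdot2^{\lfloor (n-4)/4\rfloor} &\text{if $n\equiv0$ or $1\pmod 4$},\\ 2^{\lfloor (n+2)/4\rfloor} &\text{if $n\equiv2$ or $3\pmod 4$.} \end{cases} \]
   Context: An integer polygon is a polygon (with any number $m\geq3$ of sides) whose side lengths are all positive integers; its perimeter is the sum of its side lengths. Reading the side lengths of an $m$-gon starting from any side, clockwise or anticlockwise, gives an $m$-tuple; two polygons are equivalent if they have the same number $m$ of sides and the $m$-tuple of one can be obtained from that of the other by cyclically re-ordering and/or reversing the entries. (The side-length tuples of integer polygons of perimeter $n$ are exactly the tuples of length $m\geq3$ of positive integers summing to $n$ with every entry less than $n/2$.) $\varphi$ is Euler's totient function and $\lfloor x\rfloor$ the floor. -}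

module Defs where

open import Data.Nat using (ℕ; zero; suc; _+_; _*_; _∸_; _^_; _≤_; _<_)
open import Data.Nat.DivMod using (_/_; _%_)
open import Data.Nat.Divisibility using (_∣?_)
open import Data.Nat.Coprimality using (coprime?)
open import Data.Nat.ListAction using (sum)
open import Data.List using (List; []; _∷_; length; map; filter; drop; take; reverse; _++_; upTo)
open import Data.List.Relation.Unary.All using (All)
open import Data.List.Relation.Unary.Any using (Any)
open import Data.List.Relation.Unary.AllPairs using (AllPairs)
open import Data.Product using (Σ; ∃; _×_)
open import Data.Sum using (_⊎_)
open import Relation.Binary.PropositionalEquality using (_≡_)
open import Relation.Nullary using (¬_)

oneTo : ℕ → List ℕ
oneTo n = map suc (upTo n)

φ : ℕ → ℕ
φ d = length (filter (λ k → coprime? k d) (oneTo d))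

necklaceSum : ℕ → ℕ
necklaceSum n = sum (map (λ d → φ d * 2 ^ ((n / suc (d ∸ 1)) ∸ 1)) (filter (λ d → d ∣? n) (oneTo n)))

correction : ℕ → ℕ
correction n with n % 4
... | 0 = 3 * 2 ^ ((n ∸ 4) / 4)
... | 1 = 3 * 2 ^ ((n ∸ 4) / 4)
... | _ = 2 ^ ((n + 2) / 4)

-- side-length tuple of an integer polygon of perimeter n:
-- length m ≥ 3, positive entries summing to n, every entry < n/2
IntPolygon : ℕ → List ℕ → Set
IntPolygon n xs = (3 ≤ length xs) × All (λ a → 1 ≤ a) xs × (sum xs ≡ n) × All (λ a → 2 * a < n) xs

rotate : ℕ → List ℕ → List ℕ
rotate k xs = drop k xs ++ take k xs

Equiv : List ℕ → List ℕ → Set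
Equiv xs ys = ∃ λ k → (k < length xs) × ((ys ≡ rotate k xs) ⊎ (ys ≡ reverse (rotate k xs)))

IsRepSystem : ℕ → List (List ℕ) → Set
IsRepSystem n L =
  All (IntPolygon n) L ×
  AllPairs (λ xs ys → ¬ Equiv xs ys) L ×
  (∀ xs → IntPolygon n xs → Any (Equiv xs) L)

{-# OPTIONS --safe #-}
module Submission where

-- Identify a composition of n with a cyclic binary word of length n in which every side a becomes
-- a one followed by a - 1 zeros.  Polygons up to equivalence are then the orbits of the dihedral
-- group on the words that contain a one and have no gap of length at least n/2, and Burnside's
-- lemma applies.  The rotation by k fixes pairs of commuting words of lengths k and n - k, of which
-- there are 2 ^ gcd k n by Euclid's algorithm; the reflections fix pairs of palindromes.  The
-- excluded words need no Burnside count of their own: up to rotation each nonzero one has exactly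
-- one form 1 0 ⋯ 0 u with ⌈n/2⌉ - 1 displayed zeros and u an arbitrary word of length ⌊n/2⌋, and it
-- is symmetric exactly when what follows the first one of u is a palindrome.

open import Defs
open import Data.Bool using (Bool; true; false)
import Data.Bool.Properties as Bool
open import Data.Nat
open import Data.Nat.Properties
open import Data.Nat.Coprimality using (coprime?; coprime⇒gcd≡1; gcd≡1⇒coprime)
open import Data.Nat.Divisibility
open import Data.Nat.DivMod
open import Data.Nat.GCD
open import Data.Nat.Induction using (<-wellFounded)
open import Data.Nat.ListAction using (sum)
open import Data.Nat.ListAction.Properties using (sum-++)
open import Data.Nat.Solver using (module +-*-Solver)
open import Data.List using (List; []; _∷_; _++_; [_]; length; map; filter; take; drop; reverse; replicate; initLast; _∷ʳ′_; upTo)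
open import Data.List.Properties hiding (sum-++)
open import Data.List.Membership.Propositional using (_∈_; find)
open import Data.List.Membership.Propositional.Properties
open import Data.List.Relation.Unary.All as All using (All; []; _∷_)
import Data.List.Relation.Unary.All.Properties as All
open import Data.List.Relation.Unary.Any as Any using (Any; here; there)
open import Data.List.Relation.Unary.AllPairs using (AllPairs; []; _∷_)
open import Data.List.Relation.Unary.Unique.Propositional using (Unique)
import Data.List.Relation.Unary.Unique.Propositional.Properties as Unique
open import Data.Product using (∃; ∃₂; _×_; _,_; proj₁; proj₂)
open import Data.Sum using (_⊎_; inj₁; inj₂)
open import Algebra.Properties.CommutativeSemigroup +-commutativeSemigroup using (x∙yz≈y∙xz)
open import Function using (_∘_; it)
open import Induction.WellFounded using (Acc; acc)
open import Relation.Nullary using (¬_; Dec; yes; no; contradiction)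
open import Relation.Nullary.Decidable using (_×-dec_; _⊎-dec_; map′)
open import Relation.Binary.PropositionalEquality hiding ([_])
open ≡-Reasoning
open +-*-Solver using (solve; _:=_; _:+_; _:*_; con)

-- Summing the stabilizer orders over all words of length `n` gives `2 * n` for every dihedral
-- orbit, polygon or not, so the other orbits have to be weighed and removed. A rotation class with
-- a long gap has one canonical form, but reflection may join two classes: a chiral orbit contains
-- two forms, a symmetric orbit only one. With `t` = ⌊n/2⌋, the number `2 ^ t + achiral t` is
-- therefore twice the number of gapped orbits, and the zero word is one orbit more.
--
-- The constants of the formula come out as follows. The reflections have
-- `n * (2 ^ t + 2 * 2 ^ ((n ∸ 3) / 2))` fixed points in all. Their `2 ^ t` cancels the `2 ^ t` of
-- the gapped words, which leaves the middle term. What remains of the removed orbits is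
-- `2 + achiral t`, twice the case term; since `achiral t` depends on the parity of `t`, the cases
-- are those of `n` modulo 4.

private
  variable
    A B P Q : Set

-- Finite sums

∑ : List A → (A → ℕ) → ℕ
∑ xs f = sum (map f xs)

⟦_⟧ : Dec P → ℕ
⟦ yes _ ⟧ = 1
⟦ no _ ⟧ = 0

⟦⟧-yes : (P? : Dec P) → P → ⟦ P? ⟧ ≡ 1
⟦⟧-yes (yes _) _ = refl
⟦⟧-yes (no ¬p) p = contradiction p ¬p

⟦⟧-no : (P? : Dec P) → ¬ P → ⟦ P? ⟧ ≡ 0
⟦⟧-no (yes p) ¬p = contradiction p ¬p
⟦⟧-no (no _) _ = refl

⟦⟧-cong : (P? : Dec P) (Q? : Dec Q) → (P → Q) → (Q → P) → ⟦ P? ⟧ ≡ ⟦ Q? ⟧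
⟦⟧-cong (yes p) Q? f g = sym (⟦⟧-yes Q? (f p))
⟦⟧-cong (no ¬p) Q? f g = sym (⟦⟧-no Q? (¬p ∘ g))

⟦⟧-× : (P? : Dec P) (Q? : Dec Q) → ⟦ P? ×-dec Q? ⟧ ≡ ⟦ P? ⟧ * ⟦ Q? ⟧
⟦⟧-× (yes _) (yes _) = refl
⟦⟧-× (yes _) (no _) = refl
⟦⟧-× (no _) _ = refl

∑-cong : {f g : A → ℕ} (xs : List A) → (∀ {x} → x ∈ xs → f x ≡ g x) → ∑ xs f ≡ ∑ xs g
∑-cong [] h = refl
∑-cong (x ∷ xs) h = cong₂ _+_ (h (here refl)) (∑-cong xs (h ∘ there))

∑-++ : (f : A → ℕ) (xs ys : List A) → ∑ (xs ++ ys) f ≡ ∑ xs f + ∑ ys f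
∑-++ f xs ys = trans (cong sum (map-++ f xs ys)) (sum-++ (map f xs) (map f ys))

∑-map : (f : A → ℕ) (g : B → A) (xs : List B) → ∑ (map g xs) f ≡ ∑ xs (f ∘ g)
∑-map f g xs = cong sum (sym (map-∘ xs))

∑-const : (xs : List A) (c : ℕ) → ∑ xs (λ _ → c) ≡ length xs * c
∑-const [] c = refl
∑-const (_ ∷ xs) c = cong (c +_) (∑-const xs c)

∑-0 : {f : A → ℕ} (xs : List A) → (∀ {x} → x ∈ xs → f x ≡ 0) → ∑ xs f ≡ 0
∑-0 xs h = trans (∑-cong xs h) (trans (∑-const xs 0) (*-zeroʳ (length xs)))

∑-+ : (f g : A → ℕ) (xs : List A) → ∑ xs (λ x → f x + g x) ≡ ∑ xs f + ∑ xs g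
∑-+ f g [] = refl
∑-+ f g (x ∷ xs) = begin
  f x + g x + ∑ xs (λ y → f y + g y)  ≡⟨ cong (f x + g x +_) (∑-+ f g xs) ⟩
  f x + g x + (∑ xs f + ∑ xs g)       ≡⟨ +-assoc (f x) (g x) _ ⟩
  f x + (g x + (∑ xs f + ∑ xs g))     ≡⟨ cong (f x +_) (x∙yz≈y∙xz (g x) (∑ xs f) (∑ xs g)) ⟩
  f x + (∑ xs f + (g x + ∑ xs g))     ≡⟨ +-assoc (f x) (∑ xs f) _ ⟨
  f x + ∑ xs f + (g x + ∑ xs g)       ∎

∑-*ˡ : (c : ℕ) (f : A → ℕ) (xs : List A) → ∑ xs (λ x → c * f x) ≡ c * ∑ xs f
∑-*ˡ c f [] = sym (*-zeroʳ c)
∑-*ˡ c f (x ∷ xs) = trans (cong (c * f x +_) (∑-*ˡ c f xs)) (sym (*-distribˡ-+ c (f x) _))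

∑-*ʳ : (c : ℕ) (f : A → ℕ) (xs : List A) → ∑ xs (λ x → f x * c) ≡ ∑ xs f * c
∑-*ʳ c f xs = trans (∑-cong xs (λ {x} _ → *-comm (f x) c)) (trans (∑-*ˡ c f xs) (*-comm c _))

∑-swap : (f : A → B → ℕ) (xs : List A) (ys : List B) →
         ∑ xs (λ x → ∑ ys (f x)) ≡ ∑ ys (λ y → ∑ xs (λ x → f x y))
∑-swap f [] ys = sym (∑-0 ys (λ _ → refl))
∑-swap f (x ∷ xs) ys = trans (cong (∑ ys (f x) +_) (∑-swap f xs ys)) (sym (∑-+ (f x) _ ys))

∑-filter : {P : A → Set} (P? : ∀ x → Dec (P x)) (f : A → ℕ) (xs : List A) →
           ∑ (filter P? xs) f ≡ ∑ xs (λ x → ⟦ P? x ⟧ * f x)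
∑-filter P? f [] = refl
∑-filter P? f (x ∷ xs) with P? x
... | yes _ = cong₂ _+_ (sym (+-identityʳ (f x))) (∑-filter P? f xs)
... | no _ = ∑-filter P? f xs

-- `rel` puts all entries satisfying `H` into one class, while distinct entries are inequivalent, so
-- exactly one entry contributes. Used with equality for `∑-δ` and with `Equiv` for the
-- representative of an orbit.
∑-one-class : {_∼_ : A → A → Set} {H : A → Set} {f : A → ℕ} {c : ℕ} (xs : List A) →
  AllPairs (λ x y → ¬ x ∼ y) xs →
  (∀ {x y} → x ∈ xs → y ∈ xs → H x → H y → x ∼ y) →
  (∀ {x} → x ∈ xs → H x → f x ≡ c) →
  (∀ {x} → x ∈ xs → ¬ H x → f x ≡ 0) →
  Any H xs → ∑ xs f ≡ c
∑-one-class {c = c} (x ∷ xs) (x≁ ∷ _) rel hit miss (here hx) =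
  trans (cong₂ _+_ (hit (here refl) hx)
                   (∑-0 xs λ y∈ → miss (there y∈) λ hy →
                     All.lookup x≁ y∈ (rel (here refl) (there y∈) hx hy)))
        (+-identityʳ c)
∑-one-class {H = H} (x ∷ xs) (x≁ ∷ ≁s) rel hit miss (there h) =
  cong₂ _+_ (miss (here refl) ¬hx)
            (∑-one-class xs ≁s (λ p q → rel (there p) (there q)) (hit ∘ there) (miss ∘ there) h)
  where
  ¬hx : ¬ H x
  ¬hx hx = let (y , y∈ , hy) = find h in
           All.lookup x≁ y∈ (rel (here refl) (there y∈) hx hy)

∑-δ : {f : A → ℕ} {v : A} (xs : List A) → Unique xs → v ∈ xs →
      (∀ {x} → x ∈ xs → x ≢ v → f x ≡ 0) → ∑ xs f ≡ f v
∑-δ {f = f} {v} xs uniq v∈ miss =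
  ∑-one-class {H = _≡ v} xs uniq (λ _ _ p q → trans p (sym q)) (λ _ → cong f) miss
    (Any.map sym v∈)

∑-upTo-first : (f : ℕ → ℕ) (n : ℕ) → ∑ (upTo (suc n)) f ≡ f 0 + ∑ (upTo n) (f ∘ suc)
∑-upTo-first f n = cong (f 0 +_)
  (trans (cong (λ ks → ∑ ks f) (sym (map-upTo suc n))) (∑-map f suc (upTo n)))

∑-upTo-last : (f : ℕ → ℕ) (n : ℕ) → ∑ (upTo (suc n)) f ≡ ∑ (upTo n) f + f n
∑-upTo-last f n = begin
  ∑ (upTo (suc n)) f        ≡⟨ cong (λ ks → ∑ ks f) (upTo-∷ʳ n) ⟨
  ∑ (upTo n ++ [ n ]) f     ≡⟨ ∑-++ f (upTo n) [ n ] ⟩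
  ∑ (upTo n) f + (f n + 0)  ≡⟨ cong (∑ (upTo n) f +_) (+-identityʳ (f n)) ⟩
  ∑ (upTo n) f + f n        ∎

∑-upTo-+ : (f : ℕ → ℕ) (m n : ℕ) → ∑ (upTo (m + n)) f ≡ ∑ (upTo m) f + ∑ (upTo n) (f ∘ (m +_))
∑-upTo-+ f zero n = refl
∑-upTo-+ f (suc m) n = begin
  ∑ (upTo (suc (m + n))) f                                        ≡⟨ ∑-upTo-first f (m + n) ⟩
  f 0 + ∑ (upTo (m + n)) (f ∘ suc)                                ≡⟨ cong (f 0 +_) (∑-upTo-+ (f ∘ suc) m n) ⟩
  f 0 + (∑ (upTo m) (f ∘ suc) + ∑ (upTo n) (f ∘ (suc m +_)))      ≡⟨ +-assoc (f 0) _ _ ⟨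
  f 0 + ∑ (upTo m) (f ∘ suc) + ∑ (upTo n) (f ∘ (suc m +_))        ≡⟨ cong (_+ ∑ (upTo n) (f ∘ (suc m +_))) (∑-upTo-first f m) ⟨
  ∑ (upTo (suc m)) f + ∑ (upTo n) (f ∘ (suc m +_))                ∎

-- Binary words

Word : Set
Word = List Bool

_≟ʷ_ : (u v : Word) → Dec (u ≡ v)
_≟ʷ_ = ≡-dec Bool._≟_

words : ℕ → List Word
words zero = [ [] ]
words (suc n) = map (true ∷_) (words n) ++ map (false ∷_) (words n)

∑-words-suc : (f : Word → ℕ) (n : ℕ) →
              ∑ (words (suc n)) f ≡ ∑ (words n) (f ∘ (true ∷_)) + ∑ (words n) (f ∘ (false ∷_))
∑-words-suc f n = trans (∑-++ f (map (true ∷_) (words n)) _)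
  (cong₂ _+_ (∑-map f (true ∷_) (words n)) (∑-map f (false ∷_) (words n)))

∈-words⁻ : {w : Word} (n : ℕ) → w ∈ words n → length w ≡ n
∈-words⁻ zero (here refl) = refl
∈-words⁻ (suc n) w∈ with ∈-++⁻ (map (true ∷_) (words n)) w∈
... | inj₁ w∈ˡ with ∈-map⁻ (true ∷_) w∈ˡ
...   | _ , v∈ , refl = cong suc (∈-words⁻ n v∈)
∈-words⁻ (suc n) w∈ | inj₂ w∈ʳ with ∈-map⁻ (false ∷_) w∈ʳ
...   | _ , v∈ , refl = cong suc (∈-words⁻ n v∈)

∈-words⁺ : (w : Word) → w ∈ words (length w)
∈-words⁺ [] = here refl
∈-words⁺ (true ∷ w) = ∈-++⁺ˡ (∈-map⁺ (true ∷_) (∈-words⁺ w))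
∈-words⁺ (false ∷ w) = ∈-++⁺ʳ (map (true ∷_) (words (length w))) (∈-map⁺ (false ∷_) (∈-words⁺ w))

words-unique : (n : ℕ) → Unique (words n)
words-unique zero = [] ∷ []
words-unique (suc n) = Unique.++⁺
  (Unique.map⁺ ∷-injectiveʳ (words-unique n))
  (Unique.map⁺ ∷-injectiveʳ (words-unique n))
  λ (p , q) → disjoint (∈-map⁻ (true ∷_) p) (∈-map⁻ (false ∷_) q)
  where
  disjoint : ∀ {w} → (∃ λ u → u ∈ words n × w ≡ true ∷ u) → ¬ (∃ λ u → u ∈ words n × w ≡ false ∷ u)
  disjoint (_ , _ , refl) (_ , _ , ())

length-words : (n : ℕ) → length (words n) ≡ 2 ^ n
length-words zero = refl
length-words (suc n) = begin
  length (words (suc n))                      ≡⟨ length-++ (map (true ∷_) (words n)) ⟩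
  length (map (true ∷_) (words n)) + length (map (false ∷_) (words n))
    ≡⟨ cong₂ _+_ (length-map _ (words n)) (length-map _ (words n)) ⟩
  length (words n) + length (words n)         ≡⟨ cong (λ l → l + l) (length-words n) ⟩
  2 ^ n + 2 ^ n                               ≡⟨ cong (2 ^ n +_) (+-identityʳ (2 ^ n)) ⟨
  2 ^ suc n                                   ∎

∑-words-δ : (f : Word → ℕ) (n : ℕ) (v : Word) → length v ≡ n → ∑ (words n) (λ w → ⟦ v ≟ʷ w ⟧ * f w) ≡ f v
∑-words-δ f _ v refl = trans
  (∑-δ (words (length v)) (words-unique (length v)) (∈-words⁺ v)
    λ {w} _ w≢v → cong (_* f w) (⟦⟧-no (v ≟ʷ w) (w≢v ∘ sym)))
  (trans (cong (_* f v) (⟦⟧-yes (v ≟ʷ v) refl)) (+-identityʳ (f v)))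

∑-words-≟ : (n : ℕ) (v : Word) → length v ≡ n → ∑ (words n) (λ w → ⟦ v ≟ʷ w ⟧) ≡ 1
∑-words-≟ n v ∣v∣ = trans (∑-cong (words n) (λ {w} _ → sym (*-identityʳ ⟦ v ≟ʷ w ⟧))) (∑-words-δ (λ _ → 1) n v ∣v∣)

∑-words-+ : (f : Word → ℕ) (k l : ℕ) →
            ∑ (words (k + l)) f ≡ ∑ (words k) (λ u → ∑ (words l) (λ v → f (u ++ v)))
∑-words-+ f zero l = sym (+-identityʳ _)
∑-words-+ f (suc k) l = begin
  ∑ (words (suc (k + l))) f
    ≡⟨ ∑-words-suc f (k + l) ⟩
  ∑ (words (k + l)) (f ∘ (true ∷_)) + ∑ (words (k + l)) (f ∘ (false ∷_))
    ≡⟨ cong₂ _+_ (∑-words-+ (f ∘ (true ∷_)) k l) (∑-words-+ (f ∘ (false ∷_)) k l) ⟩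
  ∑ (words k) (λ u → ∑ (words l) (λ v → f (true ∷ u ++ v))) +
  ∑ (words k) (λ u → ∑ (words l) (λ v → f (false ∷ u ++ v)))
    ≡⟨ ∑-words-suc (λ u → ∑ (words l) (λ v → f (u ++ v))) k ⟨
  ∑ (words (suc k)) (λ u → ∑ (words l) (λ v → f (u ++ v)))
    ∎

-- Rotations and conjugacy

rot : List A → List A
rot [] = []
rot (x ∷ xs) = xs ++ [ x ]

rot^ : ℕ → List A → List A
rot^ zero w = w
rot^ (suc k) w = rot^ k (rot w)

rot^-++ : (u v : List A) → rot^ (length u) (u ++ v) ≡ v ++ u
rot^-++ [] v = sym (++-identityʳ v)
rot^-++ (x ∷ u) v = begin
  rot^ (length u) ((u ++ v) ++ [ x ])  ≡⟨ cong (rot^ (length u)) (++-assoc u v [ x ]) ⟩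
  rot^ (length u) (u ++ v ++ [ x ])    ≡⟨ rot^-++ u (v ++ [ x ]) ⟩
  (v ++ [ x ]) ++ u                    ≡⟨ ++-assoc v [ x ] u ⟩
  v ++ x ∷ u                           ∎

rot^-length : (w : List A) → rot^ (length w) w ≡ w
rot^-length w = trans (cong (rot^ (length w)) (sym (++-identityʳ w))) (rot^-++ w [])

length-rot : (w : List A) → length (rot w) ≡ length w
length-rot [] = refl
length-rot (x ∷ w) = trans (length-++ w) (+-comm (length w) 1)

length-rot^ : (k : ℕ) (w : List A) → length (rot^ k w) ≡ length w
length-rot^ zero w = refl
length-rot^ (suc k) w = trans (length-rot^ k (rot w)) (length-rot w)

infix 4 _≈_

-- Conjugacy through a cut instead of an exponent: symmetry and compatibility with `reverse` and
-- `enc` are then immediate, and only transitivity passes through `rot^`.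
_≈_ : List A → List A → Set
y ≈ x = ∃₂ λ p q → y ≡ p ++ q × x ≡ q ++ p

≈-refl : {y : List A} → y ≈ y
≈-refl {y = y} = [] , y , refl , sym (++-identityʳ y)

≡⇒≈ : {x y : List A} → x ≡ y → x ≈ y
≡⇒≈ refl = ≈-refl

≈-sym : {x y : List A} → x ≈ y → y ≈ x
≈-sym (p , q , e , e′) = q , p , e′ , e

-- The cut moves by one letter: `c` leaves the end of `q` and joins the front of `p`.
≈-rot : {x y : List A} → rot x ≈ y → x ≈ y
≈-rot {x = []} x≈y = x≈y
≈-rot {x = c ∷ x} {y} (p , q , e , refl) with initLast q
... | [] = [ c ] , x , refl , (begin
  p               ≡⟨ ++-identityʳ p ⟨
  p ++ []         ≡⟨ e ⟨
  x ++ [ c ]      ∎)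
... | q′ ∷ʳ′ d with ∷ʳ-injective x (p ++ q′) (trans e (sym (++-assoc p q′ [ d ])))
...   | refl , refl = c ∷ p , q′ , refl , ++-assoc q′ [ c ] p

rot^⇒≈ : (k : ℕ) {x y : List A} → rot^ k x ≡ y → x ≈ y
rot^⇒≈ zero e = ≡⇒≈ e
rot^⇒≈ (suc k) e = ≈-rot (rot^⇒≈ k e)

≈⇒rot^ : {x y : List A} → x ≈ y → ∃ λ k → k ≤ length x × rot^ k x ≡ y
≈⇒rot^ (p , q , refl , refl) =
  length p , subst (length p ≤_) (sym (length-++ p)) (m≤m+n _ _) , rot^-++ p q

≈-trans : {x y z : List A} → x ≈ y → y ≈ z → x ≈ z
≈-trans {x = x} {y} {z} x≈y y≈z with ≈⇒rot^ x≈y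
... | k , _ , e = go k e
  where
  go : (k : ℕ) {x : List _} → rot^ k x ≡ y → x ≈ z
  go zero refl = y≈z
  go (suc k) e = ≈-rot (go k e)

≈-reverse : {x y : List A} → x ≈ y → reverse x ≈ reverse y
≈-reverse (p , q , refl , refl) = reverse q , reverse p , reverse-++ p q , reverse-++ q p

≈-flip : {x y : List A} → reverse x ≈ y → x ≈ reverse y
≈-flip {x = x} {y} rx≈y = subst (_≈ reverse y) (reverse-involutive x) (≈-reverse rx≈y)

≈-length : {x y : List A} → x ≈ y → length x ≡ length y
≈-length (p , q , refl , refl) = trans (length-++ p) (trans (+-comm (length p) _) (sym (length-++ q)))

≈-All : {P : A → Set} {x y : List A} → x ≈ y → All P x → All P y
≈-All (p , q , refl , refl) ps = All.++⁺ (All.++⁻ʳ p ps) (All.++⁻ˡ p ps)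

-- Sums over the rotations of a word, with multiplicity

orbitSum : ℕ → (List A → ℕ) → List A → ℕ
orbitSum n f x = ∑ (upTo n) (λ k → f (rot^ k x))

-- Shifting the start trades the term at `0` for the term at `n`, and these agree by `rot^-length`.
orbitSum-rot : (f : List A → ℕ) (x : List A) → orbitSum (length x) f (rot x) ≡ orbitSum (length x) f x
orbitSum-rot f x = +-cancelˡ-≡ (f x) _ _ (begin
  f x + orbitSum n f (rot x)                  ≡⟨ ∑-upTo-first (λ k → f (rot^ k x)) n ⟨
  ∑ (upTo (suc n)) (λ k → f (rot^ k x))       ≡⟨ ∑-upTo-last (λ k → f (rot^ k x)) n ⟩
  orbitSum n f x + f (rot^ n x)               ≡⟨ cong (λ y → orbitSum n f x + f y) (rot^-length x) ⟩
  orbitSum n f x + f x                        ≡⟨ +-comm (orbitSum n f x) (f x) ⟩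
  f x + orbitSum n f x                        ∎)
  where n = length x

orbitSum-≈ : (f : List A → ℕ) (n : ℕ) {x y : List A} → length x ≡ n → x ≈ y → orbitSum n f x ≡ orbitSum n f y
orbitSum-≈ f n {x} {y} ∣x∣ x≈y with ≈⇒rot^ x≈y
... | k , _ , e = go k ∣x∣ e
  where
  go : (k : ℕ) {x : List _} → length x ≡ n → rot^ k x ≡ y → orbitSum n f x ≡ orbitSum n f y
  go zero _ refl = refl
  go (suc k) {x} refl e = trans (sym (orbitSum-rot f x)) (go k (length-rot x) e)

orbitSum-≉ : (n : ℕ) {x w : Word} → ¬ x ≈ w → orbitSum n (λ y → ⟦ y ≟ʷ w ⟧) x ≡ 0
orbitSum-≉ n {x} {w} x≉w = ∑-0 (upTo n) λ {k} _ → ⟦⟧-no (rot^ k x ≟ʷ w) (x≉w ∘ rot^⇒≈ k)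

∑-orbitSum : (n : ℕ) (x : Word) → length x ≡ n →
             ∑ (words n) (λ w → orbitSum n (λ y → ⟦ y ≟ʷ w ⟧) x) ≡ n
∑-orbitSum n x ∣x∣ = begin
  ∑ (words n) (λ w → ∑ (upTo n) (λ k → ⟦ rot^ k x ≟ʷ w ⟧))
    ≡⟨ ∑-swap (λ w k → ⟦ rot^ k x ≟ʷ w ⟧) (words n) (upTo n) ⟩
  ∑ (upTo n) (λ k → ∑ (words n) (λ w → ⟦ rot^ k x ≟ʷ w ⟧))
    ≡⟨ ∑-cong (upTo n) (λ {k} _ → ∑-words-≟ n (rot^ k x) (trans (length-rot^ k x) ∣x∣)) ⟩
  ∑ (upTo n) (λ _ → 1)
    ≡⟨ ∑-const (upTo n) 1 ⟩
  length (upTo n) * 1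
    ≡⟨ trans (*-identityʳ _) (length-upTo n) ⟩
  n ∎

-- Words fixed by a rotation

++-injective : {u u′ v v′ : List A} → length u ≡ length u′ → u ++ v ≡ u′ ++ v′ → u ≡ u′ × v ≡ v′
++-injective {u = []} {[]} _ e = refl , e
++-injective {u = x ∷ u} {y ∷ u′} l e with ∷-injective e
... | refl , e′ with ++-injective {u = u} {u′} (suc-injective l) e′
...   | refl , e″ = refl , e″

commuting : ℕ → ℕ → ℕ
commuting k l = ∑ (words k) (λ u → ∑ (words l) (λ v → ⟦ (v ++ u) ≟ʷ (u ++ v) ⟧))

commuting-comm : (k l : ℕ) → commuting k l ≡ commuting l k
commuting-comm k l = trans
  (∑-swap (λ u v → ⟦ (v ++ u) ≟ʷ (u ++ v) ⟧) (words k) (words l))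
  (∑-cong (words l) λ {v} _ → ∑-cong (words k) λ {u} _ → ⟦⟧-cong ((v ++ u) ≟ʷ (u ++ v)) ((u ++ v) ≟ʷ (v ++ u)) sym sym)

-- A longer word commuting with u starts with u, and what follows commutes with u too.
commuting-+ : (k l : ℕ) → commuting k (k + l) ≡ commuting k l
commuting-+ k l = ∑-cong (words k) λ {u} u∈ → begin
  ∑ (words (k + l)) (λ v → ⟦ (v ++ u) ≟ʷ (u ++ v) ⟧)
    ≡⟨ ∑-words-+ (λ v → ⟦ (v ++ u) ≟ʷ (u ++ v) ⟧) k l ⟩
  ∑ (words k) (λ u′ → ∑ (words l) (λ v → ⟦ ((u′ ++ v) ++ u) ≟ʷ (u ++ u′ ++ v) ⟧))
    ≡⟨ ∑-cong (words k) (λ {u′} u′∈ → trans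
         (∑-cong (words l) λ {v} _ → step u u′ v (trans (∈-words⁻ k u∈) (sym (∈-words⁻ k u′∈))))
         (∑-*ˡ ⟦ u ≟ʷ u′ ⟧ _ (words l))) ⟩
  ∑ (words k) (λ u′ → ⟦ u ≟ʷ u′ ⟧ * ∑ (words l) (λ v → ⟦ (v ++ u′) ≟ʷ (u′ ++ v) ⟧))
    ≡⟨ ∑-words-δ (λ u′ → ∑ (words l) (λ v → ⟦ (v ++ u′) ≟ʷ (u′ ++ v) ⟧)) k u (∈-words⁻ k u∈) ⟩
  ∑ (words l) (λ v → ⟦ (v ++ u) ≟ʷ (u ++ v) ⟧) ∎
  where
  step : (u u′ v : Word) → length u ≡ length u′ →
         ⟦ ((u′ ++ v) ++ u) ≟ʷ (u ++ u′ ++ v) ⟧ ≡ ⟦ u ≟ʷ u′ ⟧ * ⟦ (v ++ u′) ≟ʷ (u′ ++ v) ⟧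
  step u u′ v l = trans
    (⟦⟧-cong (((u′ ++ v) ++ u) ≟ʷ (u ++ u′ ++ v)) ((u ≟ʷ u′) ×-dec ((v ++ u′) ≟ʷ (u′ ++ v))) to from)
    (⟦⟧-× (u ≟ʷ u′) ((v ++ u′) ≟ʷ (u′ ++ v)))
    where
    to : (u′ ++ v) ++ u ≡ u ++ u′ ++ v → u ≡ u′ × v ++ u′ ≡ u′ ++ v
    to e with ++-injective {u = u′} {u} (sym l) (trans (sym (++-assoc u′ v u)) e)
    ... | refl , e′ = refl , e′
    from : u ≡ u′ × v ++ u′ ≡ u′ ++ v → (u′ ++ v) ++ u ≡ u ++ u′ ++ v
    from (refl , e) = trans (++-assoc u v u) (cong (u ++_) e)

gcd-+ʳ : (k l : ℕ) → gcd k (k + l) ≡ gcd k l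
gcd-+ʳ k l = ∣-antisym
  (gcd-greatest (gcd[m,n]∣m k (k + l)) (∣m+n∣m⇒∣n (gcd[m,n]∣n k (k + l)) (gcd[m,n]∣m k (k + l))))
  (gcd-greatest (gcd[m,n]∣m k l) (∣m∣n⇒∣m+n (gcd[m,n]∣m k l) (gcd[m,n]∣n k l)))

∑-words-1 : (n : ℕ) → ∑ (words n) (λ _ → 1) ≡ 2 ^ n
∑-words-1 n = trans (∑-const (words n) 1) (trans (*-identityʳ _) (length-words n))

commuting-zeroˡ : (l : ℕ) → commuting 0 l ≡ 2 ^ l
commuting-zeroˡ l = trans (+-identityʳ _) (trans
  (∑-cong (words l) λ {v} _ → ⟦⟧-yes ((v ++ []) ≟ʷ v) (++-identityʳ v))
  (∑-words-1 l))

commuting-gcd : (k l : ℕ) → commuting k l ≡ 2 ^ gcd k l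
commuting-gcd k l = go k l (<-wellFounded (k + l))
  where
  go : (k l : ℕ) → Acc _<_ (k + l) → commuting k l ≡ 2 ^ gcd k l
  go zero l _ = trans (commuting-zeroˡ l) (cong (2 ^_) (sym (gcd-identityˡ l)))
  go k@(suc _) zero _ = trans (commuting-comm k 0) (trans (commuting-zeroˡ k) (cong (2 ^_) (sym (gcd-identityʳ k))))
  go k@(suc k′) l@(suc l′) (acc rec) with ≤-total k l
  ... | inj₁ k≤l with m≤n⇒∃[o]m+o≡n k≤l
  ...   | o , refl = begin
    commuting k (k + o)  ≡⟨ commuting-+ k o ⟩
    commuting k o        ≡⟨ go k o (rec (m<n+m (k + o) z<s)) ⟩
    2 ^ gcd k o          ≡⟨ cong (2 ^_) (gcd-+ʳ k o) ⟨
    2 ^ gcd k (k + o)    ∎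
  go k@(suc k′) l@(suc l′) (acc rec) | inj₂ l≤k with m≤n⇒∃[o]m+o≡n l≤k
  ...   | o , refl = begin
    commuting (l + o) l  ≡⟨ commuting-comm (l + o) l ⟩
    commuting l (l + o)  ≡⟨ commuting-+ l o ⟩
    commuting l o        ≡⟨ go l o (rec (m<m+n (l + o) z<s)) ⟩
    2 ^ gcd l o          ≡⟨ cong (2 ^_) (gcd-+ʳ l o) ⟨
    2 ^ gcd l (l + o)    ≡⟨ cong (2 ^_) (gcd-comm l (l + o)) ⟩
    2 ^ gcd (l + o) l    ∎

∑-rotation-fixed : (n k : ℕ) → k ≤ n → ∑ (words n) (λ w → ⟦ rot^ k w ≟ʷ w ⟧) ≡ 2 ^ gcd k n
∑-rotation-fixed n k k≤n with m≤n⇒∃[o]m+o≡n k≤n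
... | l , refl = begin
  ∑ (words (k + l)) (λ w → ⟦ rot^ k w ≟ʷ w ⟧)
    ≡⟨ ∑-words-+ (λ w → ⟦ rot^ k w ≟ʷ w ⟧) k l ⟩
  ∑ (words k) (λ u → ∑ (words l) (λ v → ⟦ rot^ k (u ++ v) ≟ʷ (u ++ v) ⟧))
    ≡⟨ ∑-cong (words k) (λ {u} u∈ → ∑-cong (words l) λ {v} _ →
         cong (λ w → ⟦ w ≟ʷ (u ++ v) ⟧)
           (trans (cong (λ j → rot^ j (u ++ v)) (sym (∈-words⁻ k u∈))) (rot^-++ u v))) ⟩
  commuting k l        ≡⟨ commuting-gcd k l ⟩
  2 ^ gcd k l          ≡⟨ cong (2 ^_) (gcd-+ʳ k l) ⟨
  2 ^ gcd k (k + l)    ∎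

-- Words fixed by a reflection

palindrome? : (w : Word) → Dec (reverse w ≡ w)
palindrome? w = reverse w ≟ʷ w

palindromes : ℕ → ℕ
palindromes n = ∑ (words n) (λ w → ⟦ palindrome? w ⟧)

-- Stripping both ends leaves a palindrome; the first letter is free and determines the last.
palindromes-2+ : (n : ℕ) → palindromes (2 + n) ≡ 2 * palindromes n
palindromes-2+ n = begin
  palindromes (2 + n)
    ≡⟨ ∑-words-suc (λ w → ⟦ palindrome? w ⟧) (suc n) ⟩
  ends true + ends false
    ≡⟨ cong₂ _+_ (ends-palindromes true) (ends-palindromes false) ⟩
  palindromes n + palindromes n
    ≡⟨ cong (palindromes n +_) (+-identityʳ (palindromes n)) ⟨
  2 * palindromes n ∎
  where
  ends : Bool → ℕ
  ends x = ∑ (words (suc n)) (λ w → ⟦ palindrome? (x ∷ w) ⟧)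

  reverse-ends : ∀ x v y → reverse (x ∷ v ++ [ y ]) ≡ y ∷ reverse v ++ [ x ]
  reverse-ends x v y = trans (unfold-reverse x (v ++ [ y ])) (cong (_++ [ x ]) (reverse-++ v [ y ]))

  -- Letters are compared as one-letter words so that `∑-words-δ` can evaluate the sum over the last
  -- letter.
  last-bit : ∀ x y v → ⟦ palindrome? (x ∷ v ++ [ y ]) ⟧ ≡ ⟦ [ x ] ≟ʷ [ y ] ⟧ * ⟦ palindrome? v ⟧
  last-bit x y v = trans
    (⟦⟧-cong (palindrome? (x ∷ v ++ [ y ])) (([ x ] ≟ʷ [ y ]) ×-dec palindrome? v) to from)
    (⟦⟧-× ([ x ] ≟ʷ [ y ]) (palindrome? v))
    where
    to : reverse (x ∷ v ++ [ y ]) ≡ x ∷ v ++ [ y ] → [ x ] ≡ [ y ] × reverse v ≡ v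
    to e with ∷-injective (trans (sym (reverse-ends x v y)) e)
    ... | refl , e′ = refl , ∷ʳ-injectiveˡ (reverse v) v e′
    from : [ x ] ≡ [ y ] × reverse v ≡ v → reverse (x ∷ v ++ [ y ]) ≡ x ∷ v ++ [ y ]
    from (refl , e) = trans (reverse-ends x v x) (cong (λ u → x ∷ u ++ [ x ]) e)

  ends-palindromes : ∀ x → ends x ≡ palindromes n
  ends-palindromes x = begin
    ends x
      ≡⟨ cong (λ l → ∑ (words l) (λ w → ⟦ palindrome? (x ∷ w) ⟧)) (+-comm 1 n) ⟩
    ∑ (words (n + 1)) (λ w → ⟦ palindrome? (x ∷ w) ⟧)
      ≡⟨ ∑-words-+ (λ w → ⟦ palindrome? (x ∷ w) ⟧) n 1 ⟩
    ∑ (words n) (λ v → ∑ (words 1) (λ y → ⟦ palindrome? (x ∷ v ++ y) ⟧))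
      ≡⟨ ∑-cong (words n) (λ {v} _ → trans
           (cong₂ (λ a b → a + (b + 0)) (last-bit x true v) (last-bit x false v))
           (∑-words-δ (λ _ → ⟦ palindrome? v ⟧) 1 [ x ] refl)) ⟩
    palindromes n ∎

-- Cut `w` as `u ++ v` with `v` of length `k`. Its reverse is `reverse v ++ reverse u`, which
-- `rot^ k` turns into `reverse u ++ reverse v`; comparing the pieces shows that `w` is fixed
-- exactly when both are palindromes.
∑-reflection-fixed : (n k : ℕ) → k ≤ n →
  ∑ (words n) (λ w → ⟦ rot^ k (reverse w) ≟ʷ w ⟧) ≡ palindromes (n ∸ k) * palindromes k
∑-reflection-fixed n k k≤n with n ∸ k | m∸n+n≡m k≤n
... | l | refl = begin
  ∑ (words (l + k)) (λ w → ⟦ rot^ k (reverse w) ≟ʷ w ⟧)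
    ≡⟨ ∑-words-+ (λ w → ⟦ rot^ k (reverse w) ≟ʷ w ⟧) l k ⟩
  ∑ (words l) (λ u → ∑ (words k) (λ v → ⟦ rot^ k (reverse (u ++ v)) ≟ʷ (u ++ v) ⟧))
    ≡⟨ ∑-cong (words l) (λ {u} _ → trans
         (∑-cong (words k) λ {v} v∈ → factor u v (∈-words⁻ k v∈))
         (∑-*ˡ ⟦ palindrome? u ⟧ _ (words k))) ⟩
  ∑ (words l) (λ u → ⟦ palindrome? u ⟧ * palindromes k)
    ≡⟨ ∑-*ʳ (palindromes k) _ (words l) ⟩
  palindromes l * palindromes k ∎
  where
  factor : ∀ u v → length v ≡ k →
           ⟦ rot^ k (reverse (u ++ v)) ≟ʷ (u ++ v) ⟧ ≡ ⟦ palindrome? u ⟧ * ⟦ palindrome? v ⟧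
  factor u v refl = trans
    (⟦⟧-cong (rot^ k (reverse (u ++ v)) ≟ʷ (u ++ v)) (palindrome? u ×-dec palindrome? v)
      (λ e → ++-injective {u = reverse u} (length-reverse u) (trans (sym rotated) e))
      (λ (e , e′) → trans rotated (cong₂ _++_ e e′)))
    (⟦⟧-× (palindrome? u) (palindrome? v))
    where
    rotated : rot^ (length v) (reverse (u ++ v)) ≡ reverse u ++ reverse v
    rotated = begin
      rot^ (length v) (reverse (u ++ v))
        ≡⟨ cong₂ rot^ (sym (length-reverse v)) (reverse-++ u v) ⟩
      rot^ (length (reverse v)) (reverse v ++ reverse u)
        ≡⟨ rot^-++ (reverse v) (reverse u) ⟩
      reverse u ++ reverse v ∎

-- Words containing a long gap

zeros : ℕ → Word
zeros n = replicate n false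

zeros-++-true : (m : ℕ) {u v w : Word} → u ++ true ∷ v ≡ zeros m ++ w →
                ∃ λ u′ → u ≡ zeros m ++ u′ × u′ ++ true ∷ v ≡ w
zeros-++-true zero {u} e = u , refl , e
zeros-++-true (suc m) {[]} ()
zeros-++-true (suc m) {x ∷ u} e with ∷-injective e
... | refl , e′ with zeros-++-true m {u} e′
...   | u′ , e″ , e‴ = u′ , cong (false ∷_) e″ , e‴

gapped : ℕ → Word → Word
gapped m u = true ∷ zeros m ++ u

length-gapped : (m : ℕ) (u : Word) → length (gapped m u) ≡ suc m + length u
length-gapped m u = cong suc (trans (length-++ (zeros m)) (cong (_+ length u) (length-replicate m)))

gapped-tail : (m : ℕ) {p q u : Word} → true ∷ zeros m ++ u ≡ p ++ true ∷ q → p ≢ [] →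
              ∃ λ u′ → p ≡ gapped m u′ × u ≡ u′ ++ true ∷ q
gapped-tail m {[]} e p≢[] = contradiction refl p≢[]
gapped-tail m {x ∷ p} e _ with ∷-injective e
... | refl , e′ with zeros-++-true m {p} (sym e′)
...   | u′ , e″ , e‴ = u′ , cong (true ∷_) e″ , sym e‴

-- If u is not longer than the gap, the gap overlaps no other gap of the same length, so the only
-- nontrivial rotation that could start with such a gap exchanges two equal halves.
gapped-≈-injective : (m : ℕ) {u u′ : Word} → length u ≤ suc m → gapped m u ≈ gapped m u′ → u ≡ u′
gapped-≈-injective m ∣u∣≤ ([] , q , refl , e′) =
  ++-cancelˡ (zeros m) _ _ (sym (∷-injectiveʳ (trans e′ (++-identityʳ _))))
gapped-≈-injective m ∣u∣≤ (p@(_ ∷ _) , [] , e , e′) =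
  ++-cancelˡ (zeros m) _ _ (∷-injectiveʳ (trans e (trans (++-identityʳ p) (sym e′))))
gapped-≈-injective m {u} {u′} ∣u∣≤ (p@(_ ∷ _) , q@(true ∷ _) , e , e′) with gapped-tail m {p} e (λ ())
... | s , refl , refl with gapped-tail m {q} e′ (λ ())
...   | s′ , refl , refl = begin
  s ++ gapped m s′  ≡⟨ cong (_++ gapped m s′) s≡[] ⟩
  gapped m s′       ≡⟨ cong (gapped m) s′≡[] ⟩
  gapped m []       ≡⟨ cong (gapped m) s≡[] ⟨
  gapped m s        ≡⟨ cong (_++ gapped m s) s′≡[] ⟨
  s′ ++ gapped m s  ∎
  where
  len≡0 : {xs : Word} → length xs ≡ 0 → xs ≡ []
  len≡0 {[]} _ = refl
  len : suc m + (length s + length s′) ≤ suc m + 0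
  len = ≤-trans (≤-reflexive (begin
    suc m + (length s + length s′)         ≡⟨ +-comm (suc m) _ ⟩
    length s + length s′ + suc m           ≡⟨ +-assoc (length s) _ _ ⟩
    length s + (length s′ + suc m)         ≡⟨ cong (length s +_) (+-comm (length s′) (suc m)) ⟩
    length s + (suc m + length s′)         ≡⟨ cong (length s +_) (length-gapped m s′) ⟨
    length s + length (gapped m s′)        ≡⟨ length-++ s ⟨
    length (s ++ gapped m s′)              ∎)) (≤-trans ∣u∣≤ (≤-reflexive (sym (+-identityʳ (suc m)))))
  sum≡0 : length s + length s′ ≡ 0
  sum≡0 = n≤0⇒n≡0 (+-cancelˡ-≤ (suc m) _ _ len)
  s≡[] : s ≡ []
  s≡[] = len≡0 (m+n≡0⇒m≡0 (length s) sum≡0)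
  s′≡[] : s′ ≡ []
  s′≡[] = len≡0 (m+n≡0⇒n≡0 (length s) sum≡0)
gapped-≈-injective m _ (_ ∷ _ , false ∷ _ , _ , ())

-- Leading zeros of `u` prolong the gap in front of it, and the reflected word has to show that
-- whole gap again at its beginning. So they stay in place, and only what follows the first one is
-- reversed.
mirror : Word → Word
mirror [] = []
mirror (false ∷ u) = false ∷ mirror u
mirror (true ∷ u) = true ∷ reverse u

zeros-snoc : (m : ℕ) (u : Word) → zeros m ++ false ∷ u ≡ zeros (suc m) ++ u
zeros-snoc zero u = refl
zeros-snoc (suc m) u = cong (false ∷_) (zeros-snoc m u)

reverse-zeros : (m : ℕ) → reverse (zeros m) ≡ zeros m
reverse-zeros zero = refl
reverse-zeros (suc m) = begin
  reverse (zeros (suc m))     ≡⟨ unfold-reverse false (zeros m) ⟩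
  reverse (zeros m) ++ [ false ]  ≡⟨ cong (_++ [ false ]) (reverse-zeros m) ⟩
  zeros m ++ [ false ]        ≡⟨ zeros-snoc m [] ⟩
  zeros (suc m) ++ []         ≡⟨ ++-identityʳ _ ⟩
  zeros (suc m)               ∎

-- The block `gapped m [ true ]` is a palindrome: reversal carries it to the end, and a rotation
-- returns it to the front. A leading zero of `u` is first absorbed into the gap.
reverse-gapped : (m : ℕ) (u : Word) → reverse (gapped m u) ≈ gapped m (mirror u)
reverse-gapped m [] = zeros m , [ true ] ,
  trans (cong reverse (cong (true ∷_) (++-identityʳ (zeros m))))
        (trans (unfold-reverse true (zeros m)) (cong (_++ [ true ]) (reverse-zeros m))) ,
  cong (true ∷_) (++-identityʳ (zeros m))
reverse-gapped m (false ∷ u) =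
  subst₂ (λ a b → reverse (true ∷ a) ≈ true ∷ b) (sym (zeros-snoc m u)) (sym (zeros-snoc m (mirror u)))
         (reverse-gapped (suc m) u)
reverse-gapped m (true ∷ u) = reverse u , gapped m [ true ] ,
  (begin
    reverse (gapped m (true ∷ u))
      ≡⟨ cong reverse (cong (true ∷_) (++-assoc (zeros m) [ true ] u)) ⟨
    reverse (gapped m [ true ] ++ u)
      ≡⟨ reverse-++ (gapped m [ true ]) u ⟩
    reverse u ++ reverse (true ∷ zeros m ++ [ true ])
      ≡⟨ cong (reverse u ++_) (trans (unfold-reverse true (zeros m ++ [ true ]))
           (cong (_++ [ true ]) (trans (reverse-++ (zeros m) [ true ]) (cong (true ∷_) (reverse-zeros m))))) ⟩
    reverse u ++ gapped m [ true ] ∎) ,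
  cong (true ∷_) (sym (++-assoc (zeros m) [ true ] (reverse u)))

achiral : ℕ → ℕ
achiral t = ∑ (words t) (λ u → ⟦ mirror u ≟ʷ u ⟧)

achiral-suc : (t : ℕ) → achiral (suc t) ≡ palindromes t + achiral t
achiral-suc t = trans (∑-words-suc (λ u → ⟦ mirror u ≟ʷ u ⟧) t) (cong₂ _+_
  (∑-cong (words t) λ {u} _ → ⟦⟧-cong ((true ∷ reverse u) ≟ʷ (true ∷ u)) (palindrome? u) ∷-injectiveʳ (cong (true ∷_)))
  (∑-cong (words t) λ {u} _ → ⟦⟧-cong ((false ∷ mirror u) ≟ʷ (false ∷ u)) (mirror u ≟ʷ u) ∷-injectiveʳ (cong (false ∷_))))

-- The word of a composition

-- Because of `pred` a side `0` would get the block of a side `1`; `Positive` rules this out where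
-- length or injectivity matters.
enc : List ℕ → Word
enc [] = []
enc (a ∷ as) = gapped (pred a) (enc as)

Positive : List ℕ → Set
Positive = All (1 ≤_)

enc-++ : (as bs : List ℕ) → enc (as ++ bs) ≡ enc as ++ enc bs
enc-++ [] bs = refl
enc-++ (a ∷ as) bs = cong (true ∷_) (trans (cong (zeros (pred a) ++_) (enc-++ as bs)) (sym (++-assoc (zeros (pred a)) _ _)))

length-enc : {as : List ℕ} → Positive as → length (enc as) ≡ sum as
length-enc [] = refl
length-enc {suc a ∷ as} (_ ∷ ps) = trans (length-gapped a (enc as)) (cong (suc a +_) (length-enc ps))

enc-≈ : {as bs : List ℕ} → as ≈ bs → enc as ≈ enc bs
enc-≈ (p , q , refl , refl) = enc p , enc q , enc-++ p q , enc-++ q p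

enc-zeros : (a b : ℕ) (as bs : List ℕ) → zeros a ++ enc as ≡ zeros b ++ enc bs → a ≡ b × enc as ≡ enc bs
enc-zeros zero zero as bs e = refl , e
enc-zeros zero (suc b) [] bs ()
enc-zeros zero (suc b) (_ ∷ as) bs ()
enc-zeros (suc a) zero as [] ()
enc-zeros (suc a) zero as (_ ∷ _) ()
enc-zeros (suc a) (suc b) as bs e with enc-zeros a b as bs (∷-injectiveʳ e)
... | refl , e′ = refl , e′

enc-injective : {as bs : List ℕ} → Positive as → Positive bs → enc as ≡ enc bs → as ≡ bs
enc-injective [] [] e = refl
enc-injective [] (_ ∷ _) ()
enc-injective (_ ∷ _) [] ()
enc-injective {suc a ∷ as} {suc b ∷ bs} (_ ∷ ps) (_ ∷ qs) e with enc-zeros a b as bs (∷-injectiveʳ e)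
... | refl , e′ = cong (suc a ∷_) (enc-injective ps qs e′)

-- The ones mark the beginnings of the sides, so a cut just before a one falls between two sides.
enc-split : (as : List ℕ) {p q : Word} → enc as ≡ p ++ true ∷ q →
            ∃₂ λ bs cs → as ≡ bs ++ cs × p ≡ enc bs × true ∷ q ≡ enc cs
enc-split [] {[]} ()
enc-split [] {_ ∷ _} ()
enc-split (a ∷ as) {[]} e = [] , a ∷ as , refl , refl , sym e
enc-split (a ∷ as) {p@(_ ∷ _)} e with gapped-tail (pred a) {p} e (λ ())
... | p′ , refl , e′ with enc-split as {p′} e′
...   | bs , cs , refl , refl , e″ = a ∷ bs , cs , refl , refl , e″

-- The rotated word is again an encoding and hence begins with a one, so `enc-split` applies to the
-- cut.
enc-≈⁻ : {as bs : List ℕ} → Positive as → Positive bs → enc as ≈ enc bs → as ≈ bs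
enc-≈⁻ {as} {bs} ps qs (p , [] , e , e′) =
  ≡⇒≈ (enc-injective ps qs (trans e (trans (++-identityʳ p) (sym e′))))
enc-≈⁻ {as} {[]} ps qs (p , x ∷ q , e , ())
enc-≈⁻ {as} {b ∷ bs} ps qs (p , false ∷ q , e , ())
enc-≈⁻ {as} {bs} ps qs (p , true ∷ q , e , e′) with enc-split as {p} e
... | cs , ds , refl , refl , refl′ = cs , ds , refl ,
  enc-injective qs (All.++⁺ (All.++⁻ʳ cs ps) (All.++⁻ˡ cs ps))
    (trans e′ (trans (cong (_++ enc cs) refl′) (sym (enc-++ ds cs))))

-- In the reversed word every block ends with its one instead of starting with it. An additional one
-- in front hands each block the one of its predecessor, and the last one is left over.
enc-reverse : (as : List ℕ) → true ∷ reverse (enc as) ≡ enc (reverse as) ++ [ true ]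
enc-reverse [] = refl
enc-reverse (a ∷ as) = begin
  true ∷ reverse (true ∷ z ++ enc as)
    ≡⟨ cong (true ∷_) (trans (unfold-reverse true (z ++ enc as)) (cong (_++ [ true ]) (reverse-++ z (enc as)))) ⟩
  true ∷ (reverse (enc as) ++ reverse z) ++ [ true ]
    ≡⟨ cong (λ r → true ∷ (reverse (enc as) ++ r) ++ [ true ]) (reverse-zeros (pred a)) ⟩
  (true ∷ reverse (enc as) ++ z) ++ [ true ]
    ≡⟨ cong (λ r → (r ++ z) ++ [ true ]) (enc-reverse as) ⟩
  ((enc (reverse as) ++ [ true ]) ++ z) ++ [ true ]
    ≡⟨ cong (_++ [ true ]) (++-assoc (enc (reverse as)) [ true ] z) ⟩
  (enc (reverse as) ++ true ∷ z) ++ [ true ]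
    ≡⟨ cong (λ r → (enc (reverse as) ++ true ∷ r) ++ [ true ]) (++-identityʳ z) ⟨
  (enc (reverse as) ++ enc [ a ]) ++ [ true ]
    ≡⟨ cong (_++ [ true ]) (trans (cong enc (unfold-reverse a as)) (enc-++ (reverse as) [ a ])) ⟨
  enc (reverse (a ∷ as)) ++ [ true ] ∎
  where z = zeros (pred a)

reverse-enc-≈ : (as : List ℕ) → reverse (enc as) ≈ enc (reverse as)
reverse-enc-≈ as with enc (reverse as) | enc-reverse as
... | [] | e = ≡⇒≈ (∷-injectiveʳ e)
... | true ∷ w | e = w , [ true ] , ∷-injectiveʳ e , refl
... | false ∷ w | ()

decode : (w : Word) → ∃₂ λ j as → Positive as × w ≡ zeros j ++ enc as
decode [] = 0 , [] , [] , refl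
decode (false ∷ w) with decode w
... | j , as , ps , refl = suc j , as , ps , refl
decode (true ∷ w) with decode w
... | j , as , ps , refl = 0 , suc j ∷ as , s≤s z≤n ∷ ps , refl

decode-true : (w : Word) → ∃ λ as → Positive as × true ∷ w ≡ enc as
decode-true w with decode (true ∷ w)
... | zero , as , ps , e = as , ps , e

-- Leading zeros are all that keeps a nonzero word from being an encoding; rotated to the end, they
-- lengthen the last side.
enc-surjective : (w : Word) → (w ≡ zeros (length w)) ⊎ (∃ λ as → Positive as × w ≈ enc as)
enc-surjective w with decode w
... | j , [] , _ , refl = inj₁ (begin
  zeros j ++ []                      ≡⟨ ++-identityʳ (zeros j) ⟩
  zeros j                            ≡⟨ cong zeros (length-replicate j) ⟨
  zeros (length (zeros j))           ≡⟨ cong (zeros ∘ length) (++-identityʳ (zeros j)) ⟨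
  zeros (length (zeros j ++ []))     ∎)
... | j , a ∷ as , _ , refl with decode-true ((zeros (pred a) ++ enc as) ++ zeros j)
...   | bs , qs , e = inj₂ (bs , qs , zeros j , enc (a ∷ as) , refl , sym e)

-- Equivalence of polygons

All-reverse : {P : A → Set} {xs : List A} → All P xs → All P (reverse xs)
All-reverse [] = []
All-reverse {P = P} {x ∷ xs} (p ∷ ps) =
  subst (All P) (sym (unfold-reverse x xs)) (All.++⁺ (All-reverse ps) (p ∷ []))

drop-length-++ : (p q : List A) → drop (length p) (p ++ q) ≡ q
drop-length-++ [] q = refl
drop-length-++ (_ ∷ p) q = drop-length-++ p q

take-length-++ : (p q : List A) → take (length p) (p ++ q) ≡ p
take-length-++ [] q = refl
take-length-++ (x ∷ p) q = cong (x ∷_) (take-length-++ p q)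

≈⇒rotate : {as bs : List ℕ} → 0 < length as → as ≈ bs → ∃ λ k → k < length as × bs ≡ rotate k as
-- A cut at the very end is replaced by the trivial one, as the exponent must stay below the length.
≈⇒rotate 0<∣as∣ (p , [] , refl , refl) = 0 , 0<∣as∣ , sym (trans (++-identityʳ _) (++-identityʳ p))
≈⇒rotate _ (p , q@(_ ∷ _) , refl , refl) =
  length p , subst (length p <_) (sym (length-++ p)) (m<m+n _ z<s) ,
  sym (cong₂ _++_ (drop-length-++ p q) (take-length-++ p q))

rotate-≈ : (k : ℕ) (as : List ℕ) → as ≈ rotate k as
rotate-≈ k as = take k as , drop k as , sym (take++drop≡id k as) , refl

-- `Equiv` reverses after rotating, whereas here the reversal comes first; `≈-flip` exchanges the
-- two.
Equiv⁺ : {as bs : List ℕ} → 0 < length as → as ≈ bs ⊎ reverse as ≈ bs → Equiv as bs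
Equiv⁺ 0<∣as∣ (inj₁ as≈bs) with ≈⇒rotate 0<∣as∣ as≈bs
... | k , k< , e = k , k< , inj₁ e
Equiv⁺ {bs = bs} 0<∣as∣ (inj₂ ras≈bs) with ≈⇒rotate 0<∣as∣ (≈-flip ras≈bs)
... | k , k< , e = k , k< , inj₂ (trans (sym (reverse-involutive bs)) (cong reverse e))

Equiv⁻ : {as bs : List ℕ} → Equiv as bs → as ≈ bs ⊎ reverse as ≈ bs
Equiv⁻ {as} (k , _ , inj₁ refl) = inj₁ (rotate-≈ k as)
Equiv⁻ {as} (k , _ , inj₂ refl) = inj₂ (≈-reverse (rotate-≈ k as))

Equiv? : (as bs : List ℕ) → Dec (Equiv as bs)
Equiv? as bs = anyUpTo? (λ k → (bs ≟ˡ rotate k as) ⊎-dec (bs ≟ˡ reverse (rotate k as))) (length as)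
  where
  _≟ˡ_ : (xs ys : List ℕ) → Dec (xs ≡ ys)
  _≟ˡ_ = ≡-dec _≟_

-- Existence of a system of representatives

IntPolygon? : (n : ℕ) (as : List ℕ) → Dec (IntPolygon n as)
IntPolygon? n as = (3 ≤? length as) ×-dec (All.all? (1 ≤?_) as ×-dec ((sum as ≟ n) ×-dec All.all? (λ a → 2 * a <? n) as))

polygon-nonempty : {n : ℕ} {as : List ℕ} → IntPolygon n as → 0 < length as
polygon-nonempty (3≤ , _) = <-≤-trans z<s 3≤

greedy : {n : ℕ} {xss : List (List ℕ)} → All (IntPolygon n) xss →
  ∃ λ L → All (IntPolygon n) L × AllPairs (λ xs ys → ¬ Equiv xs ys) L × All (λ xs → Any (Equiv xs) L) xss
greedy [] = [] , [] , [] , []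
greedy {xss = xs ∷ _} (poly ∷ polys) with greedy polys
... | L , ps , ≁s , covered with Any.any? (Equiv? xs) L
...   | yes rep = L , ps , ≁s , rep ∷ covered
-- The newcomer goes in front, so `AllPairs` asks for exactly the non-equivalences that the failed
-- search provides.
...   | no ¬rep = xs ∷ L , poly ∷ ps , All.¬Any⇒All¬ L ¬rep ∷ ≁s ,
                  here (Equiv⁺ (polygon-nonempty poly) (inj₁ ≈-refl)) ∷ All.map there covered

composition : Word → List ℕ
composition w = proj₁ (proj₂ (decode w))

composition-enc : {as : List ℕ} → Positive as → composition (enc as) ≡ as
composition-enc {as} ps with decode (enc as)
... | j , bs , qs , e = sym (enc-injective ps qs (proj₂ (enc-zeros 0 j as bs e)))

-- A finite list of candidates for `greedy`: a polygon of perimeter `n` can be read off its word of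
-- length `n`.
polygons : ℕ → List (List ℕ)
polygons n = filter (IntPolygon? n) (map composition (words n))

∈-polygons : {n : ℕ} {as : List ℕ} → IntPolygon n as → as ∈ polygons n
∈-polygons {n} {as} poly@(_ , ps , sum≡n , _) = ∈-filter⁺ (IntPolygon? n)
  (subst₂ (λ bs l → bs ∈ map composition (words l)) (composition-enc ps) (trans (length-enc ps) sum≡n)
    (∈-map⁺ composition (∈-words⁺ (enc as))))
  poly

repSystem : (n : ℕ) → ∃ (IsRepSystem n)
repSystem n with greedy (All.all-filter (IntPolygon? n) (map composition (words n)))
... | L , ps , ≁s , covered = L , ps , ≁s , λ xs poly → All.lookup covered (∈-polygons poly)

-- Burnside's lemma

visits : ℕ → Word → Word → ℕ
visits n x w = orbitSum n (λ y → ⟦ y ≟ʷ w ⟧) x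

-- Counts those of the `n` rotations and `n` reflections that carry `x` to `w`; for `x` equal to `w`
-- this is the order of the stabilizer.
dihedralVisits : ℕ → Word → Word → ℕ
dihedralVisits n x w = visits n x w + visits n (reverse x) w

infix 4 _≋_

_≋_ : Word → Word → Set
x ≋ y = x ≈ y ⊎ reverse x ≈ y

≋-sym : {x y : Word} → x ≋ y → y ≋ x
≋-sym (inj₁ x≈y) = inj₁ (≈-sym x≈y)
≋-sym (inj₂ rx≈y) = inj₂ (≈-sym (≈-flip rx≈y))

≋-trans : {x y z : Word} → x ≋ y → y ≋ z → x ≋ z
≋-trans (inj₁ p) (inj₁ q) = inj₁ (≈-trans p q)
≋-trans (inj₁ p) (inj₂ q) = inj₂ (≈-trans (≈-reverse p) q)
≋-trans (inj₂ p) (inj₁ q) = inj₂ (≈-trans p q)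
≋-trans (inj₂ p) (inj₂ q) = inj₁ (≈-trans (≈-flip p) q)

dihedralVisits-disjoint : (n : ℕ) {x w : Word} → ¬ x ≋ w → dihedralVisits n x w ≡ 0
dihedralVisits-disjoint n ¬p = cong₂ _+_ (orbitSum-≉ n (¬p ∘ inj₁)) (orbitSum-≉ n (¬p ∘ inj₂))

-- Moving the starting point within its orbit only permutes the `2 * n` images; a reflection
-- exchanges the two summands.
dihedralVisits-≋ : (n : ℕ) {x y : Word} (w : Word) → length x ≡ n → x ≋ y → dihedralVisits n x w ≡ dihedralVisits n y w
dihedralVisits-≋ n {x} w ∣x∣ (inj₁ x≈y) = cong₂ _+_
  (orbitSum-≈ (λ y → ⟦ y ≟ʷ w ⟧) n ∣x∣ x≈y)
  (orbitSum-≈ (λ y → ⟦ y ≟ʷ w ⟧) n (trans (length-reverse x) ∣x∣) (≈-reverse x≈y))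
dihedralVisits-≋ n {x} {y} w ∣x∣ (inj₂ rx≈y) = trans (+-comm (visits n x w) _) (cong₂ _+_
  (orbitSum-≈ (λ y → ⟦ y ≟ʷ w ⟧) n (trans (length-reverse x) ∣x∣) rx≈y)
  (orbitSum-≈ (λ y → ⟦ y ≟ʷ w ⟧) n ∣x∣ (≈-flip rx≈y)))

∑-dihedralVisits : (n : ℕ) (x : Word) → length x ≡ n → ∑ (words n) (dihedralVisits n x) ≡ 2 * n
∑-dihedralVisits n x ∣x∣ = begin
  ∑ (words n) (dihedralVisits n x)
    ≡⟨ ∑-+ (visits n x) (visits n (reverse x)) (words n) ⟩
  ∑ (words n) (visits n x) + ∑ (words n) (visits n (reverse x))
    ≡⟨ cong₂ _+_ (∑-orbitSum n x ∣x∣) (∑-orbitSum n (reverse x) (trans (length-reverse x) ∣x∣)) ⟩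
  n + n
    ≡⟨ cong (n +_) (+-identityʳ n) ⟨
  2 * n ∎

-- Double counting of the pairs of a word and a symmetry that fixes it.
∑-stabilizers : (n : ℕ) → ∑ (words n) (λ w → dihedralVisits n w w) ≡
  ∑ (upTo n) (λ k → 2 ^ gcd k n) + ∑ (upTo n) (λ k → palindromes (n ∸ k) * palindromes k)
∑-stabilizers n = begin
  ∑ (words n) (λ w → dihedralVisits n w w)
    ≡⟨ ∑-+ (λ w → visits n w w) (λ w → visits n (reverse w) w) (words n) ⟩
  ∑ (words n) (λ w → visits n w w) + ∑ (words n) (λ w → visits n (reverse w) w)
    ≡⟨ cong₂ _+_ (∑-swap (λ w k → ⟦ rot^ k w ≟ʷ w ⟧) (words n) (upTo n))
                 (∑-swap (λ w k → ⟦ rot^ k (reverse w) ≟ʷ w ⟧) (words n) (upTo n)) ⟩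
  ∑ (upTo n) (λ k → ∑ (words n) (λ w → ⟦ rot^ k w ≟ʷ w ⟧)) +
  ∑ (upTo n) (λ k → ∑ (words n) (λ w → ⟦ rot^ k (reverse w) ≟ʷ w ⟧))
    ≡⟨ cong₂ _+_ (∑-cong (upTo n) λ k∈ → ∑-rotation-fixed n _ (<⇒≤ (∈-upTo⁻ k∈)))
                 (∑-cong (upTo n) λ k∈ → ∑-reflection-fixed n _ (<⇒≤ (∈-upTo⁻ k∈))) ⟩
  ∑ (upTo n) (λ k → 2 ^ gcd k n) + ∑ (upTo n) (λ k → palindromes (n ∸ k) * palindromes k) ∎

zeros-unique : {w : Word} → All (_≡ false) w → w ≡ zeros (length w)
zeros-unique [] = refl
zeros-unique (refl ∷ ps) = cong (false ∷_) (zeros-unique ps)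

≈-zeros : (n : ℕ) {w : Word} → zeros n ≈ w → w ≡ zeros n
≈-zeros n z≈w = trans (zeros-unique (≈-All z≈w (All.replicate⁺ n refl)))
  (cong zeros (trans (sym (≈-length z≈w)) (length-replicate n)))

true≉zeros : (n : ℕ) {w : Word} → ¬ true ∷ w ≈ zeros n
true≉zeros n w≈z with ≈-All {P = _≡ false} (≈-sym w≈z) (All.replicate⁺ n refl)
... | () ∷ _

visits-zeros : (n : ℕ) → visits n (zeros n) (zeros n) ≡ n
visits-zeros n = begin
  visits n (zeros n) (zeros n)
    ≡⟨ ∑-cong (upTo n) (λ {k} _ → ⟦⟧-yes (rot^ k (zeros n) ≟ʷ zeros n) (≈-zeros n (rot^⇒≈ k refl))) ⟩
  ∑ (upTo n) (λ _ → 1)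
    ≡⟨ ∑-const (upTo n) 1 ⟩
  length (upTo n) * 1
    ≡⟨ trans (*-identityʳ _) (length-upTo n) ⟩
  n ∎

-- Stabilizers of polygons, gapped words and the zero word

HasGap : ℕ → Word → Set
HasGap m w = ∃ λ u → w ≈ gapped m u

hasGap? : (m : ℕ) (w : Word) → Dec (HasGap m w)
hasGap? m w = map′ to from
  -- `≈⇒rot^` may return the full length as exponent, hence the bound `suc (length w)`.
  (anyUpTo? (λ k → take (length (gapped m [])) (rot^ k w) ≟ʷ gapped m []) (suc (length w)))
  where
  l = length (gapped m [])
  gapped-++ : ∀ u → gapped m [] ++ u ≡ gapped m u
  gapped-++ u = cong (λ z → true ∷ z ++ u) (++-identityʳ (zeros m))
  to : (∃ λ k → k < suc (length w) × take l (rot^ k w) ≡ gapped m []) → HasGap m w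
  to (k , _ , e) = drop l (rot^ k w) , rot^⇒≈ k (begin
    rot^ k w                                    ≡⟨ take++drop≡id l (rot^ k w) ⟨
    take l (rot^ k w) ++ drop l (rot^ k w)      ≡⟨ cong (_++ drop l (rot^ k w)) e ⟩
    gapped m [] ++ drop l (rot^ k w)            ≡⟨ gapped-++ (drop l (rot^ k w)) ⟩
    gapped m (drop l (rot^ k w))                ∎)
  from : HasGap m w → ∃ λ k → k < suc (length w) × take l (rot^ k w) ≡ gapped m []
  from (u , w≈) with ≈⇒rot^ w≈
  ... | k , k≤ , e = k , s≤s k≤ ,
    trans (cong (take l) (trans e (sym (gapped-++ u)))) (take-length-++ (gapped m []) u)

zeros-++-enc : (m a : ℕ) (as : List ℕ) {u : Word} → zeros a ++ enc as ≡ zeros m ++ u → m ≤ a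
zeros-++-enc zero a as e = z≤n
zeros-++-enc (suc m) zero [] ()
zeros-++-enc (suc m) zero (_ ∷ _) ()
zeros-++-enc (suc m) (suc a) as e = s≤s (zeros-++-enc m a as (∷-injectiveʳ e))

-- m + 1 and t are the upper and lower halves of the perimeter n: a side is too long exactly when
-- it exceeds m, that is, when it produces a gap of at least m zeros.
module Halves (m t : ℕ) (t≤1+m : t ≤ suc m) (m≤t : m ≤ t) where

  n : ℕ
  n = suc m + t

  Short : ℕ → Set
  Short a = 2 * a < n

  short⁺ : {a : ℕ} → a ≤ m → Short a
  short⁺ {a} a≤m = s≤s (≤-trans (+-mono-≤ a≤m (≤-reflexive (+-identityʳ a))) (+-monoʳ-≤ m (≤-trans a≤m m≤t)))

  short⁻ : {a : ℕ} → Short a → a ≤ m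
  short⁻ {a} 2a<n with a ≤? m
  ... | yes a≤m = a≤m
  ... | no a≰m = contradiction 2a<n (≤⇒≯ (+-mono-≤ (≰⇒> a≰m) (≤-trans t≤1+m (≤-trans (≰⇒> a≰m) (≤-reflexive (sym (+-identityʳ a)))))))

  -- A word that displays the gap begins with a one, so it encodes some list, which is a rotation of
  -- `as`; its first side exceeds `m`.
  short-no-gap : {as : List ℕ} → Positive as → All Short as → ¬ HasGap m (enc as)
  short-no-gap {as} ps shorts (u , as≈u) with decode-true (zeros m ++ u)
  ... | suc b ∷ bs , qs@(s≤s _ ∷ _) , e with ≈-All (enc-≈⁻ ps qs (subst (enc as ≈_) e as≈u)) shorts
  ...   | short ∷ _ = <⇒≱ (short⁻ short) (zeros-++-enc m b bs (sym (∷-injectiveʳ e)))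

  -- A side above `m` has the form `suc (m + o)`; the rotation that brings it to the front displays
  -- a gap.
  no-gap-short : {as : List ℕ} → Positive as → ¬ HasGap m (enc as) → All Short as
  no-gap-short {as} ps ¬gap = All.tabulate λ a∈ → short⁺ (≤m a∈ (All.lookup ps a∈))
    where
    ≤m : ∀ {a} → a ∈ as → 1 ≤ a → a ≤ m
    ≤m {suc a} a∈ _ with suc a ≤? m
    ... | yes a≤m = a≤m
    ... | no a≰m with m≤n⇒∃[o]m+o≡n (s≤s⁻¹ (≰⇒> a≰m)) | ∈-∃++ a∈
    ...   | o , refl | bs , cs , refl = contradiction
      (zeros o ++ enc (cs ++ bs) , subst (enc as ≈_) gap (enc-≈ (bs , _ , refl , refl))) ¬gap
      where
      gap : enc (suc (m + o) ∷ cs ++ bs) ≡ gapped m (zeros o ++ enc (cs ++ bs))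
      gap = cong (true ∷_) (trans (cong (_++ enc (cs ++ bs)) (sym (++-replicate m o)))
                                  (++-assoc (zeros m) (zeros o) _))
        where
        ++-replicate : ∀ i j → zeros i ++ zeros j ≡ zeros (i + j)
        ++-replicate zero j = refl
        ++-replicate (suc i) j = cong (false ∷_) (++-replicate i j)

  -- Lets every nonzero word without a long gap count as a polygon: a single side would be `n`
  -- itself, and two sides below half of `n` add up to less than `n`.
  three-sides : (as : List ℕ) → sum as ≡ n → All Short as → 3 ≤ length as
  three-sides (a ∷ []) e (p ∷ []) =
    contradiction p (≤⇒≯ (≤-trans (≤-reflexive (trans (sym e) (+-identityʳ a))) (m≤m+n a _)))
  three-sides (a ∷ b ∷ []) e (p ∷ q ∷ []) =
    contradiction (+-mono-< p q) (<-irrefl (begin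
      2 * a + 2 * b  ≡⟨ *-distribˡ-+ 2 a b ⟨
      2 * (a + b)    ≡⟨ cong (2 *_) (trans (cong (a +_) (sym (+-identityʳ b))) e) ⟩
      2 * n          ≡⟨ cong (n +_) (+-identityʳ n) ⟩
      n + n          ∎))
  three-sides (_ ∷ _ ∷ _ ∷ _) _ _ = s≤s (s≤s (s≤s z≤n))

  ≋-gap : {as : List ℕ} {w : Word} → IntPolygon n as → enc as ≋ w → ¬ HasGap m w
  ≋-gap (_ , ps , _ , shorts) (inj₁ as≈w) (u , w≈u) = short-no-gap ps shorts (u , ≈-trans as≈w w≈u)
  ≋-gap (_ , ps , _ , shorts) (inj₂ as≈w) (u , w≈u) = short-no-gap ps shorts
    (mirror u , ≈-trans (≈-flip (≈-trans as≈w w≈u)) (reverse-gapped m u))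

  ≋-Equiv : {as bs : List ℕ} → IntPolygon n as → IntPolygon n bs → enc as ≋ enc bs → Equiv as bs
  ≋-Equiv poly@(_ , ps , _) (_ , qs , _) (inj₁ as≈bs) =
    Equiv⁺ (polygon-nonempty poly) (inj₁ (enc-≈⁻ ps qs as≈bs))
  ≋-Equiv {as} poly@(_ , ps , _) (_ , qs , _) (inj₂ ras≈bs) =
    Equiv⁺ (polygon-nonempty poly) (inj₂ (enc-≈⁻ (All-reverse ps) qs (≈-trans (≈-sym (reverse-enc-≈ as)) ras≈bs)))

  Equiv-≋ : {as bs : List ℕ} → Equiv as bs → enc bs ≋ enc as
  Equiv-≋ {as} as∼bs with Equiv⁻ as∼bs
  ... | inj₁ as≈bs = inj₁ (enc-≈ (≈-sym as≈bs))
  ... | inj₂ ras≈bs = inj₂ (≈-sym (≈-flip (≈-trans (reverse-enc-≈ as) (enc-≈ ras≈bs))))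

  -- Built to reproduce the stabilizer order of a gapped word. In the chiral case the stabilizer
  -- consists of rotations alone, which the visits of the one canonical form count; in the symmetric
  -- case equally many reflections join, hence the weight.
  gapVisits : Word → ℕ
  gapVisits w = ∑ (words t) (λ u → (1 + ⟦ mirror u ≟ʷ u ⟧) * visits n (gapped m u) w)

  -- By `gapped-≈-injective`, available because of `t≤1+m`, only the summand of the canonical form
  -- of `w` survives.
  gapVisits-gap : {w : Word} → length w ≡ n → HasGap m w → gapVisits w ≡ dihedralVisits n w w
  gapVisits-gap {w} ∣w∣ (u , w≈u) = begin
    gapVisits w
      ≡⟨ ∑-δ (words t) (words-unique t) (subst (λ l → u ∈ words l) ∣u∣ (∈-words⁺ u)) miss ⟩
    (1 + ⟦ mirror u ≟ʷ u ⟧) * visits n (gapped m u) w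
      ≡⟨ cong ((1 + ⟦ mirror u ≟ʷ u ⟧) *_) (orbitSum-≈ (λ y → ⟦ y ≟ʷ w ⟧) n ∣w∣ w≈u) ⟨
    visits n w w + ⟦ mirror u ≟ʷ u ⟧ * visits n w w
      ≡⟨ cong (visits n w w +_) reflected ⟩
    dihedralVisits n w w ∎
    where
    ∣u∣ : length u ≡ t
    ∣u∣ = +-cancelˡ-≡ (suc m) _ _ (trans (sym (length-gapped m u)) (trans (sym (≈-length w≈u)) ∣w∣))

    ∣u∣≤ : length u ≤ suc m
    ∣u∣≤ = ≤-trans (≤-reflexive ∣u∣) t≤1+m

    miss : ∀ {v} → v ∈ words t → v ≢ u → (1 + ⟦ mirror v ≟ʷ v ⟧) * visits n (gapped m v) w ≡ 0
    miss {v} v∈ v≢u = trans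
      (cong ((1 + ⟦ mirror v ≟ʷ v ⟧) *_) (orbitSum-≉ n λ v≈w → v≢u
        (sym (gapped-≈-injective m ∣u∣≤ (≈-sym (≈-trans v≈w w≈u))))))
      (*-zeroʳ (1 + ⟦ mirror v ≟ʷ v ⟧))

    rw≈ : reverse w ≈ gapped m (mirror u)
    rw≈ = ≈-trans (≈-reverse w≈u) (reverse-gapped m u)

    -- If `mirror u` is `u`, then `reverse w` is a rotation of `w` and is visited equally often;
    -- otherwise uniqueness of the form keeps `reverse w` out of the rotation class of `w`.
    reflected : ⟦ mirror u ≟ʷ u ⟧ * visits n w w ≡ visits n (reverse w) w
    reflected with mirror u ≟ʷ u
    ... | yes e = trans (+-identityʳ _) (orbitSum-≈ (λ y → ⟦ y ≟ʷ w ⟧) n ∣w∣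
                    (≈-sym (≈-trans rw≈ (≈-trans (≡⇒≈ (cong (gapped m) e)) (≈-sym w≈u)))))
    ... | no mu≢u = sym (orbitSum-≉ n λ rw≈w → mu≢u (sym (gapped-≈-injective m ∣u∣≤
                      (≈-trans (≈-sym w≈u) (≈-trans (≈-sym rw≈w) rw≈)))))

  gapVisits-no-gap : {w : Word} → ¬ HasGap m w → gapVisits w ≡ 0
  gapVisits-no-gap ¬gap = ∑-0 (words t) λ {u} _ → trans
    (cong ((1 + ⟦ mirror u ≟ʷ u ⟧) *_) (orbitSum-≉ n λ u≈w → ¬gap (u , ≈-sym u≈w)))
    (*-zeroʳ (1 + ⟦ mirror u ≟ʷ u ⟧))

  ∑-gapVisits : ∑ (words n) gapVisits ≡ (2 ^ t + achiral t) * n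
  ∑-gapVisits = begin
    ∑ (words n) gapVisits
      ≡⟨ ∑-swap (λ w u → weight u * visits n (gapped m u) w) (words n) (words t) ⟩
    ∑ (words t) (λ u → ∑ (words n) (λ w → weight u * visits n (gapped m u) w))
      ≡⟨ ∑-cong (words t) (λ {u} u∈ → trans (∑-*ˡ (weight u) (visits n (gapped m u)) (words n))
           (cong (weight u *_) (∑-orbitSum n (gapped m u)
             (trans (length-gapped m u) (cong (suc m +_) (∈-words⁻ t u∈)))))) ⟩
    ∑ (words t) (λ u → weight u * n)
      ≡⟨ ∑-*ʳ n weight (words t) ⟩
    ∑ (words t) weight * n
      ≡⟨ cong (_* n) (trans (∑-+ (λ _ → 1) (λ u → ⟦ mirror u ≟ʷ u ⟧) (words t)) (cong (_+ achiral t) (∑-words-1 t))) ⟩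
    (2 ^ t + achiral t) * n ∎
    where
    weight : Word → ℕ
    weight u = 1 + ⟦ mirror u ≟ʷ u ⟧

  module _ (L : List (List ℕ)) (L-rep : IsRepSystem n L) where

    private
      polys : All (IntPolygon n) L
      polys = proj₁ L-rep

    length-∈ : {r : List ℕ} → r ∈ L → length (enc r) ≡ n
    length-∈ r∈ with All.lookup polys r∈
    ... | _ , ps , sum≡n , _ = trans (length-enc ps) sum≡n

    polygonVisits : Word → ℕ
    polygonVisits w = ∑ L (λ r → dihedralVisits n (enc r) w)

    ∑-polygonVisits : ∑ (words n) polygonVisits ≡ length L * (2 * n)
    ∑-polygonVisits = begin
      ∑ (words n) polygonVisits
        ≡⟨ ∑-swap (λ w r → dihedralVisits n (enc r) w) (words n) L ⟩
      ∑ L (λ r → ∑ (words n) (dihedralVisits n (enc r)))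
        ≡⟨ ∑-cong L (λ {r} r∈ → ∑-dihedralVisits n (enc r) (length-∈ r∈)) ⟩
      ∑ L (λ _ → 2 * n)
        ≡⟨ ∑-const L (2 * n) ⟩
      length L * (2 * n) ∎

    polygonVisits-disjoint : {w : Word} → (∀ {r} → r ∈ L → ¬ enc r ≋ w) → polygonVisits w ≡ 0
    polygonVisits-disjoint ¬≋ = ∑-0 L (dihedralVisits-disjoint n ∘ ¬≋)

    -- Exactly one representative lies in the orbit of `w`, and it reaches `w` as often as `w`
    -- reaches itself.
    polygonVisits-polygon : {w : Word} {as : List ℕ} → IntPolygon n as → w ≈ enc as → polygonVisits w ≡ dihedralVisits n w w
    polygonVisits-polygon {w} {as} poly w≈as = ∑-one-class {H = λ r → enc r ≋ w} L (proj₁ (proj₂ L-rep))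
      (λ r∈ s∈ r≋w s≋w → ≋-Equiv (All.lookup polys r∈) (All.lookup polys s∈) (≋-trans r≋w (≋-sym s≋w)))
      (λ r∈ → dihedralVisits-≋ n w (length-∈ r∈))
      (λ r∈ → dihedralVisits-disjoint n)
      (Any.map (λ as∼r → ≋-trans (Equiv-≋ as∼r) (inj₁ (≈-sym w≈as))) (proj₂ (proj₂ L-rep) as poly))

    -- The summands belong to disjoint kinds of words: rotations of encoded polygons, words with a
    -- long gap, and the zero word, which all `2 * n` symmetries fix. Any other word would be a
    -- rotation of an encoding with only short sides, hence of a polygon.
    stabilizer : {w : Word} → length w ≡ n →
      dihedralVisits n w w ≡ polygonVisits w + gapVisits w + ⟦ zeros n ≟ʷ w ⟧ * (2 * n)
    stabilizer {w} ∣w∣ with hasGap? m w | zeros n ≟ʷ w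
    ... | yes (u , w≈u) | yes refl = contradiction (≈-sym w≈u) (true≉zeros n)
    ... | no ¬gap | yes refl = sym (begin
      polygonVisits (zeros n) + gapVisits (zeros n) + (2 * n + 0)
        ≡⟨ cong₂ (λ a b → a + b + (2 * n + 0)) (polygonVisits-disjoint ¬≋) (gapVisits-no-gap ¬gap) ⟩
      2 * n + 0
        ≡⟨ trans (+-identityʳ (2 * n)) (cong (n +_) (+-identityʳ n)) ⟩
      n + n
        ≡⟨ cong₂ _+_ (visits-zeros n) (trans (cong (λ z → visits n z (zeros n)) (reverse-zeros n)) (visits-zeros n)) ⟨
      dihedralVisits n (zeros n) (zeros n) ∎)
      where
      enc≉ : ∀ {r} → r ∈ L → ¬ enc r ≈ zeros n
      enc≉ {[]} r∈ with All.lookup polys r∈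
      ... | () , _
      enc≉ {_ ∷ _} _ = true≉zeros n
      ¬≋ : ∀ {r} → r ∈ L → ¬ enc r ≋ zeros n
      ¬≋ r∈ (inj₁ r≈) = enc≉ r∈ r≈
      ¬≋ {r} r∈ (inj₂ rr≈) = enc≉ r∈ (subst (enc r ≈_) (reverse-zeros n) (≈-flip rr≈))
    ... | yes gap | no _ = sym (begin
      polygonVisits w + gapVisits w + 0
        ≡⟨ +-identityʳ _ ⟩
      polygonVisits w + gapVisits w
        ≡⟨ cong₂ _+_ (polygonVisits-disjoint λ r∈ r≋w → ≋-gap (All.lookup polys r∈) r≋w gap) (gapVisits-gap ∣w∣ gap) ⟩
      dihedralVisits n w w ∎)
    ... | no ¬gap | no ≢zeros with enc-surjective w
    ...   | inj₁ e = contradiction (sym (trans e (cong zeros ∣w∣))) ≢zeros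
    ...   | inj₂ (as , ps , w≈as) = sym (begin
      polygonVisits w + gapVisits w + 0
        ≡⟨ +-identityʳ _ ⟩
      polygonVisits w + gapVisits w
        ≡⟨ cong₂ _+_ (polygonVisits-polygon poly w≈as) (gapVisits-no-gap ¬gap) ⟩
      dihedralVisits n w w + 0
        ≡⟨ +-identityʳ _ ⟩
      dihedralVisits n w w ∎)
      where
      shorts : All Short as
      shorts = no-gap-short ps λ (u , as≈u) → ¬gap (u , ≈-trans w≈as as≈u)
      sum≡n : sum as ≡ n
      sum≡n = trans (sym (length-enc ps)) (trans (sym (≈-length w≈as)) ∣w∣)
      poly : IntPolygon n as
      poly = three-sides as sum≡n shorts , ps , sum≡n , shorts

    burnside : ∑ (upTo n) (λ k → 2 ^ gcd k n) + ∑ (upTo n) (λ k → palindromes (n ∸ k) * palindromes k) ≡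
               length L * (2 * n) + (2 ^ t + achiral t) * n + 2 * n
    burnside = begin
      ∑ (upTo n) (λ k → 2 ^ gcd k n) + ∑ (upTo n) (λ k → palindromes (n ∸ k) * palindromes k)
        ≡⟨ ∑-stabilizers n ⟨
      ∑ (words n) (λ w → dihedralVisits n w w)
        ≡⟨ ∑-cong (words n) (λ w∈ → stabilizer (∈-words⁻ n w∈)) ⟩
      ∑ (words n) (λ w → polygonVisits w + gapVisits w + ⟦ zeros n ≟ʷ w ⟧ * (2 * n))
        ≡⟨ ∑-+ (λ w → polygonVisits w + gapVisits w) (λ w → ⟦ zeros n ≟ʷ w ⟧ * (2 * n)) (words n) ⟩
      ∑ (words n) (λ w → polygonVisits w + gapVisits w) + ∑ (words n) (λ w → ⟦ zeros n ≟ʷ w ⟧ * (2 * n))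
        ≡⟨ cong₂ _+_
             (trans (∑-+ polygonVisits gapVisits (words n)) (cong₂ _+_ ∑-polygonVisits ∑-gapVisits))
             (∑-words-δ (λ _ → 2 * n) n (zeros n) (length-replicate n)) ⟩
      length L * (2 * n) + (2 ^ t + achiral t) * n + 2 * n ∎

-- The totient sum

∑-oneTo : (f : ℕ → ℕ) (n : ℕ) → ∑ (oneTo n) f ≡ ∑ (upTo n) (f ∘ suc)
∑-oneTo f n = ∑-map f suc (upTo n)

∈-oneTo⁺ : {n k : ℕ} → suc k ≤ n → suc k ∈ oneTo n
∈-oneTo⁺ k<n = ∈-map⁺ suc (∈-upTo⁺ k<n)

oneTo-unique : (n : ℕ) → Unique (oneTo n)
oneTo-unique n = Unique.map⁺ suc-injective (Unique.upTo⁺ n)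

-- The range falls into `d` blocks of length `e`, and in each block only the last entry is a
-- multiple of `e`.
∑-multiples : (f : ℕ → ℕ) (d e : ℕ) .{{_ : NonZero e}} → (∀ k → ¬ e ∣ k → f k ≡ 0) →
              ∑ (oneTo (d * e)) f ≡ ∑ (oneTo d) (λ j → f (j * e))
∑-multiples f d e@(suc e′) off = trans (∑-oneTo f (d * e)) (trans (go d) (sym (∑-oneTo (λ j → f (j * e)) d)))
  where
  block : ∀ d → ∑ (upTo e) (λ i → f (suc (d * e + i))) ≡ f (suc d * e)
  block d = begin
    ∑ (upTo e) (λ i → f (suc (d * e + i)))
      ≡⟨ ∑-upTo-last (λ i → f (suc (d * e + i))) e′ ⟩
    ∑ (upTo e′) (λ i → f (suc (d * e + i))) + f (suc (d * e + e′))
      ≡⟨ cong₂ _+_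
           (∑-0 (upTo e′) λ {i} i∈ → off _ λ e∣ →
             >⇒∤ (s≤s (∈-upTo⁻ i∈)) (∣m+n∣m⇒∣n (subst (e ∣_) (sym (+-suc (d * e) i)) e∣) (n∣m*n d)))
           (cong f (trans (sym (+-suc (d * e) e′)) (+-comm (d * e) e))) ⟩
    f (suc d * e) ∎
  go : ∀ d → ∑ (upTo (d * e)) (f ∘ suc) ≡ ∑ (upTo d) (λ j → f (suc j * e))
  go zero = refl
  go (suc d) = begin
    ∑ (upTo (e + d * e)) (f ∘ suc)
      ≡⟨ cong (λ l → ∑ (upTo l) (f ∘ suc)) (+-comm e (d * e)) ⟩
    ∑ (upTo (d * e + e)) (f ∘ suc)
      ≡⟨ ∑-upTo-+ (f ∘ suc) (d * e) e ⟩
    ∑ (upTo (d * e)) (f ∘ suc) + ∑ (upTo e) (λ i → f (suc (d * e + i)))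
      ≡⟨ cong₂ _+_ (go d) (block d) ⟩
    ∑ (upTo d) (λ j → f (suc j * e)) + f (suc d * e)
      ≡⟨ ∑-upTo-last (λ j → f (suc j * e)) d ⟨
    ∑ (upTo (suc d)) (λ j → f (suc j * e)) ∎

φ-∑ : (d : ℕ) → φ d ≡ ∑ (oneTo d) (λ k → ⟦ coprime? k d ⟧)
φ-∑ d = begin
  φ d                                                ≡⟨ *-identityʳ (φ d) ⟨
  φ d * 1                                            ≡⟨ ∑-const (filter (λ k → coprime? k d) (oneTo d)) 1 ⟨
  ∑ (filter (λ k → coprime? k d) (oneTo d)) (λ _ → 1)  ≡⟨ ∑-filter (λ k → coprime? k d) (λ _ → 1) (oneTo d) ⟩
  ∑ (oneTo d) (λ k → ⟦ coprime? k d ⟧ * 1)           ≡⟨ ∑-cong (oneTo d) (λ {k} _ → *-identityʳ ⟦ coprime? k d ⟧) ⟩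
  ∑ (oneTo d) (λ k → ⟦ coprime? k d ⟧)               ∎

-- Only multiples `j * e` can qualify, and dividing by `e` turns the condition on them into
-- coprimality of `j` and `d`.
∑-gcd≡ : (d e : ℕ) .{{_ : NonZero e}} → ∑ (oneTo (d * e)) (λ k → ⟦ gcd k (d * e) ≟ e ⟧) ≡ φ d
∑-gcd≡ d e = begin
  ∑ (oneTo (d * e)) (λ k → ⟦ gcd k (d * e) ≟ e ⟧)
    ≡⟨ ∑-multiples (λ k → ⟦ gcd k (d * e) ≟ e ⟧) d e (λ k e∤k → ⟦⟧-no (gcd k (d * e) ≟ e)
         λ g≡e → e∤k (subst (_∣ k) g≡e (gcd[m,n]∣m k (d * e)))) ⟩
  ∑ (oneTo d) (λ j → ⟦ gcd (j * e) (d * e) ≟ e ⟧)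
    ≡⟨ ∑-cong (oneTo d) (λ {j} _ → ⟦⟧-cong (gcd (j * e) (d * e) ≟ e) (coprime? j d)
         (λ g≡e → gcd≡1⇒coprime (*-cancelˡ-≡ (gcd j d) 1 e (trans (gcd-* j) (trans g≡e (sym (*-identityʳ e))))))
         (λ c → trans (sym (gcd-* j)) (trans (cong (e *_) (coprime⇒gcd≡1 c)) (*-identityʳ e)))) ⟩
  ∑ (oneTo d) (λ j → ⟦ coprime? j d ⟧)
    ≡⟨ φ-∑ d ⟨
  φ d ∎
  where
  gcd-* : ∀ j → e * gcd j d ≡ gcd (j * e) (d * e)
  gcd-* j = trans (c*gcd[m,n]≡gcd[cm,cn] e j d) (cong₂ gcd (*-comm e j) (*-comm e d))

-- The numbers `k` are grouped by the cofactor `d` of `gcd k n` in `n`; the group of `d` has `φ d`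
-- elements. On `oneTo n` the divisor `suc (d ∸ 1)` is `d`, written so that it is visibly nonzero.
∑-gcd : (f : ℕ → ℕ) (n : ℕ) .{{_ : NonZero n}} →
        ∑ (oneTo n) (λ k → f (gcd k n)) ≡ ∑ (oneTo n) (λ d → ⟦ d ∣? n ⟧ * (φ d * f (n / suc (d ∸ 1))))
∑-gcd f n = begin
  ∑ (oneTo n) (λ k → f (gcd k n))
    ≡⟨ ∑-cong (oneTo n) (λ {k} _ → classify k) ⟩
  ∑ (oneTo n) (λ k → ∑ (oneTo n) (term k))
    ≡⟨ ∑-swap term (oneTo n) (oneTo n) ⟩
  ∑ (oneTo n) (λ d → ∑ (oneTo n) (λ k → term k d))
    ≡⟨ ∑-cong (oneTo n) (λ {d} d∈ → trans (∑-*ˡ ⟦ d ∣? n ⟧ _ (oneTo n)) (count d d∈)) ⟩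
  ∑ (oneTo n) (λ d → ⟦ d ∣? n ⟧ * (φ d * f (n / suc (d ∸ 1)))) ∎
  where
  term : ℕ → ℕ → ℕ
  term k d = ⟦ d ∣? n ⟧ * (⟦ gcd k n ≟ n / suc (d ∸ 1) ⟧ * f (n / suc (d ∸ 1)))

  positive : {d : ℕ} → d ∈ oneTo n → ∃ λ d′ → d ≡ suc d′
  positive d∈ with ∈-map⁻ suc d∈
  ... | d′ , _ , e = d′ , e

  count : ∀ d → d ∈ oneTo n →
    ⟦ d ∣? n ⟧ * ∑ (oneTo n) (λ k → ⟦ gcd k n ≟ n / suc (d ∸ 1) ⟧ * f (n / suc (d ∸ 1))) ≡
    ⟦ d ∣? n ⟧ * (φ d * f (n / suc (d ∸ 1)))
  count d d∈ with positive d∈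
  ... | d′ , refl with suc d′ ∣? n
  ...   | no _ = refl
  ...   | yes (divides e n≡) = cong (1 *_) (trans
    (∑-*ʳ (f (n / suc d′)) (λ k → ⟦ gcd k n ≟ n / suc d′ ⟧) (oneTo n))
    (cong (_* f (n / suc d′)) (begin
      ∑ (oneTo n) (λ k → ⟦ gcd k n ≟ n / suc d′ ⟧)
        ≡⟨ cong₂ (λ a b → ∑ (oneTo a) (λ k → ⟦ gcd k a ≟ b ⟧)) n≡′ (trans (cong (_/ suc d′) n≡) (m*n/n≡m e (suc d′))) ⟩
      ∑ (oneTo (suc d′ * e)) (λ k → ⟦ gcd k (suc d′ * e) ≟ e ⟧)
        ≡⟨ ∑-gcd≡ (suc d′) e ⟩
      φ (suc d′) ∎)))
    where
    n≡′ : n ≡ suc d′ * e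
    n≡′ = trans n≡ (*-comm e (suc d′))
    instance
      e≢0 : NonZero e
      e≢0 = m*n≢0⇒n≢0 (suc d′) {{subst NonZero n≡′ it}}

  classify : ∀ k → f (gcd k n) ≡ ∑ (oneTo n) (term k)
  classify k with gcd[m,n]∣n k n
  ... | divides zero n≡0 = contradiction n≡0 (≢-nonZero⁻¹ n)
  ... | divides q@(suc q′) n≡q*g = sym (trans
    (∑-δ (oneTo n) (oneTo-unique n) (∈-oneTo⁺ (∣⇒≤ q∣n)) miss)
    (begin
      ⟦ q ∣? n ⟧ * (⟦ g ≟ n / q ⟧ * f (n / q))
        ≡⟨ cong₂ (λ a b → a * (b * f (n / q))) (⟦⟧-yes (q ∣? n) q∣n) (⟦⟧-yes (g ≟ n / q) (sym n/q≡g)) ⟩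
      1 * (1 * f (n / q))  ≡⟨ trans (*-identityˡ _) (*-identityˡ _) ⟩
      f (n / q)            ≡⟨ cong f n/q≡g ⟩
      f g                  ∎))
    where
    g : ℕ
    g = gcd k n
    n≡g*q : n ≡ g * q
    n≡g*q = trans n≡q*g (*-comm q g)
    q∣n : q ∣ n
    q∣n = divides g n≡g*q
    n/q≡g : n / q ≡ g
    n/q≡g = trans (cong (_/ q) n≡g*q) (m*n/n≡m g q)
    g≢0 : NonZero g
    g≢0 = ≢-nonZero λ g≡0 → ≢-nonZero⁻¹ n (trans n≡g*q (cong (_* q) g≡0))
    miss : ∀ {d} → d ∈ oneTo n → d ≢ q → term k d ≡ 0
    miss {d} d∈ d≢q with positive d∈
    ... | d′ , refl with suc d′ ∣? n
    ...   | no _ = refl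
    ...   | yes (divides e n≡) = trans (*-identityˡ _) (cong (_* f (n / suc d′)) (⟦⟧-no (g ≟ n / suc d′) λ g≡ →
      d≢q (*-cancelˡ-≡ (suc d′) q g {{g≢0}} (begin
        g * suc d′              ≡⟨ cong (_* suc d′) (trans g≡ (trans (cong (_/ suc d′) n≡) (m*n/n≡m e (suc d′)))) ⟩
        e * suc d′              ≡⟨ n≡ ⟨
        n                       ≡⟨ n≡g*q ⟩
        g * q                   ∎))))

2*2^pred : (q : ℕ) .{{_ : NonZero q}} → 2 * 2 ^ (q ∸ 1) ≡ 2 ^ q
2*2^pred (suc q) = refl

-- Doubling raises each exponent from `n / d` minus one to `n / d`, the gcd shared by the `φ d`
-- rotations that belong to `d`.
necklaceSum-gcd : (n : ℕ) .{{_ : NonZero n}} → 2 * necklaceSum n ≡ ∑ (upTo n) (λ k → 2 ^ gcd k n)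
necklaceSum-gcd n = begin
  2 * necklaceSum n
    ≡⟨ cong (2 *_) (∑-filter (_∣? n) half (oneTo n)) ⟩
  2 * ∑ (oneTo n) (λ d → ⟦ d ∣? n ⟧ * half d)
    ≡⟨ ∑-*ˡ 2 _ (oneTo n) ⟨
  ∑ (oneTo n) (λ d → 2 * (⟦ d ∣? n ⟧ * half d))
    ≡⟨ ∑-cong (oneTo n) (λ {d} _ → double d) ⟩
  ∑ (oneTo n) (λ d → ⟦ d ∣? n ⟧ * (φ d * 2 ^ (n / suc (d ∸ 1))))
    ≡⟨ ∑-gcd (2 ^_) n ⟨
  ∑ (oneTo n) (λ k → 2 ^ gcd k n)
    ≡⟨ ∑-oneTo (λ k → 2 ^ gcd k n) n ⟩
  ∑ (upTo n) (λ k → 2 ^ gcd (suc k) n)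
    -- The ranges from 1 to `n` and from 0 to `n` minus one differ only at the ends, where both gcds
    -- are `n`.
    ≡⟨ +-cancelˡ-≡ (2 ^ gcd 0 n) _ _ (begin
         2 ^ gcd 0 n + ∑ (upTo n) (λ k → 2 ^ gcd (suc k) n)
           ≡⟨ ∑-upTo-first (λ k → 2 ^ gcd k n) n ⟨
         ∑ (upTo (suc n)) (λ k → 2 ^ gcd k n)
           ≡⟨ ∑-upTo-last (λ k → 2 ^ gcd k n) n ⟩
         ∑ (upTo n) (λ k → 2 ^ gcd k n) + 2 ^ gcd n n
           ≡⟨ +-comm _ (2 ^ gcd n n) ⟩
         2 ^ gcd n n + ∑ (upTo n) (λ k → 2 ^ gcd k n)
           ≡⟨ cong (λ g → 2 ^ g + ∑ (upTo n) (λ k → 2 ^ gcd k n)) (trans gcd[n,n] (sym (gcd-identityˡ n))) ⟩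
         2 ^ gcd 0 n + ∑ (upTo n) (λ k → 2 ^ gcd k n) ∎) ⟩
  ∑ (upTo n) (λ k → 2 ^ gcd k n) ∎
  where
  half : ℕ → ℕ
  half d = φ d * 2 ^ ((n / suc (d ∸ 1)) ∸ 1)

  gcd[n,n] : gcd n n ≡ n
  gcd[n,n] = ∣-antisym (gcd[m,n]∣m n n) (gcd-greatest ∣-refl ∣-refl)

  double : ∀ d → 2 * (⟦ d ∣? n ⟧ * half d) ≡ ⟦ d ∣? n ⟧ * (φ d * 2 ^ (n / suc (d ∸ 1)))
  double d with d ∣? n
  ... | no _ = refl
  ... | yes d∣n = begin
    2 * (1 * half d)                  ≡⟨ cong (2 *_) (*-identityˡ (half d)) ⟩
    2 * (φ d * 2 ^ (q ∸ 1))           ≡⟨ solve 2 (λ a b → con 2 :* (a :* b) := a :* (con 2 :* b)) refl (φ d) (2 ^ (q ∸ 1)) ⟩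
    φ d * (2 * 2 ^ (q ∸ 1))           ≡⟨ cong (φ d *_) (2*2^pred q {{q≢0}}) ⟩
    φ d * 2 ^ q                       ≡⟨ *-identityˡ _ ⟨
    1 * (φ d * 2 ^ q)                 ∎
    where
    q : ℕ
    q = n / suc (d ∸ 1)
    suc-pred-≤ : ∀ {d} → d ∣ n → suc (d ∸ 1) ≤ n
    suc-pred-≤ {zero} 0∣n = contradiction (0∣⇒≡0 0∣n) (≢-nonZero⁻¹ n)
    suc-pred-≤ {suc d} d∣n = ∣⇒≤ d∣n
    -- Truncated subtraction makes the doubling wrong for `q` equal to `0`; a divisor of `n` is at
    -- most `n`, so its quotient is positive.
    q≢0 : NonZero q
    q≢0 = >-nonZero (m≥n⇒m/n>0 (suc-pred-≤ d∣n))

-- Evaluation of the reflection terms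

palindromes-even : (i : ℕ) → palindromes (i * 2) ≡ 2 ^ i
palindromes-even zero = refl
palindromes-even (suc i) = trans (palindromes-2+ (i * 2)) (cong (2 *_) (palindromes-even i))

palindromes-odd : (i : ℕ) → palindromes (1 + i * 2) ≡ 2 ^ suc i
palindromes-odd zero = refl
palindromes-odd (suc i) = trans (palindromes-2+ (1 + i * 2)) (cong (2 *_) (palindromes-odd i))

∑-pairs : (f : ℕ → ℕ) (a b j : ℕ) → (∀ i → i < j → f (i * 2) ≡ a × f (1 + i * 2) ≡ b) →
          ∑ (upTo (j * 2)) f ≡ j * (a + b)
∑-pairs f a b zero h = refl
∑-pairs f a b (suc j) h = begin
  ∑ (upTo (2 + j * 2)) f
    ≡⟨ ∑-upTo-last f (1 + j * 2) ⟩
  ∑ (upTo (1 + j * 2)) f + f (1 + j * 2)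
    ≡⟨ cong (_+ f (1 + j * 2)) (∑-upTo-last f (j * 2)) ⟩
  ∑ (upTo (j * 2)) f + f (j * 2) + f (1 + j * 2)
    ≡⟨ cong₂ (λ x y → ∑ (upTo (j * 2)) f + x + y) (proj₁ (h j ≤-refl)) (proj₂ (h j ≤-refl)) ⟩
  ∑ (upTo (j * 2)) f + a + b
    ≡⟨ cong (λ x → x + a + b) (∑-pairs f a b j (λ i i<j → h i (m<n⇒m<1+n i<j))) ⟩
  j * (a + b) + a + b
    ≡⟨ solve 3 (λ j a b → j :* (a :+ b) :+ a :+ b := (con 1 :+ j) :* (a :+ b)) refl j a b ⟩
  suc j * (a + b) ∎

2^-merge : (i o : ℕ) → 2 ^ suc o * 2 ^ i ≡ 2 ^ (suc i + o)
2^-merge i o = trans (sym (^-distribˡ-+-* 2 (suc o) i)) (cong (λ k → 2 ^ suc k) (+-comm o i))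

reflections : ℕ → ℕ
reflections n = ∑ (upTo n) (λ k → palindromes (n ∸ k) * palindromes k)

-- There are `j` cuts into two even parts, with `2 ^ j` pairs of palindromes each, and `j` cuts into
-- two odd parts, whose free middle letters double the number.
reflections-even : (j : ℕ) → reflections (j * 2) ≡ j * (2 ^ j + 2 * 2 ^ j)
reflections-even j = ∑-pairs _ (2 ^ j) (2 * 2 ^ j) j terms
  where
  terms : ∀ i → i < j → palindromes (j * 2 ∸ i * 2) * palindromes (i * 2) ≡ 2 ^ j ×
                        palindromes (j * 2 ∸ (1 + i * 2)) * palindromes (1 + i * 2) ≡ 2 * 2 ^ j
  terms i i<j with m≤n⇒∃[o]m+o≡n i<j
  ... | o , refl =
    (begin
      palindromes ((suc i + o) * 2 ∸ i * 2) * palindromes (i * 2)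
        ≡⟨ cong₂ (λ a b → palindromes a * b) (trans (cong (_∸ i * 2) (shift i o)) (m+n∸n≡m (suc o * 2) (i * 2))) (palindromes-even i) ⟩
      palindromes (suc o * 2) * 2 ^ i
        ≡⟨ cong (_* 2 ^ i) (palindromes-even (suc o)) ⟩
      2 ^ suc o * 2 ^ i
        ≡⟨ 2^-merge i o ⟩
      2 ^ (suc i + o) ∎) ,
    (begin
      palindromes ((suc i + o) * 2 ∸ (1 + i * 2)) * palindromes (1 + i * 2)
        ≡⟨ cong₂ (λ a b → palindromes a * b)
             (trans (cong (_∸ (1 + i * 2)) (trans (shift i o) (sym (+-suc (1 + o * 2) (i * 2))))) (m+n∸n≡m (1 + o * 2) (1 + i * 2)))
             (palindromes-odd i) ⟩
      palindromes (1 + o * 2) * 2 ^ suc i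
        ≡⟨ cong (_* 2 ^ suc i) (palindromes-odd o) ⟩
      2 ^ suc o * 2 ^ suc i
        ≡⟨ solve 2 (λ a b → a :* (con 2 :* b) := con 2 :* (a :* b)) refl (2 ^ suc o) (2 ^ i) ⟩
      2 * (2 ^ suc o * 2 ^ i)
        ≡⟨ cong (2 *_) (2^-merge i o) ⟩
      2 * 2 ^ (suc i + o) ∎)
    where
    shift : ∀ i o → (suc i + o) * 2 ≡ suc o * 2 + i * 2
    shift = solve 2 (λ i o → (con 1 :+ i :+ o) :* con 2 := (con 1 :+ o) :* con 2 :+ i :* con 2) refl

-- Every cut yields one even and one odd part, so all terms are equal.
reflections-odd : (j : ℕ) → reflections (1 + j * 2) ≡ (1 + j * 2) * (2 * 2 ^ j)
reflections-odd j = begin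
  reflections (1 + j * 2)
    ≡⟨ ∑-upTo-last f (j * 2) ⟩
  ∑ (upTo (j * 2)) f + f (j * 2)
    ≡⟨ cong₂ _+_ (∑-pairs f (2 * 2 ^ j) (2 * 2 ^ j) j terms)
                 (cong₂ (λ a b → palindromes a * b) (m+n∸n≡m 1 (j * 2)) (palindromes-even j)) ⟩
  j * (2 * 2 ^ j + 2 * 2 ^ j) + 2 * 2 ^ j
    ≡⟨ solve 2 (λ j x → j :* (x :+ x) :+ x := (con 1 :+ j :* con 2) :* x) refl j (2 * 2 ^ j) ⟩
  (1 + j * 2) * (2 * 2 ^ j) ∎
  where
  f : ℕ → ℕ
  f k = palindromes (1 + j * 2 ∸ k) * palindromes k
  shift : ∀ i o → 1 + (suc i + o) * 2 ≡ 1 + suc o * 2 + i * 2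
  shift = solve 2 (λ i o → con 1 :+ (con 1 :+ i :+ o) :* con 2 := con 1 :+ (con 1 :+ o) :* con 2 :+ i :* con 2) refl
  terms : ∀ i → i < j → f (i * 2) ≡ 2 * 2 ^ j × f (1 + i * 2) ≡ 2 * 2 ^ j
  terms i i<j with m≤n⇒∃[o]m+o≡n i<j
  ... | o , refl =
    (begin
      palindromes (1 + (suc i + o) * 2 ∸ i * 2) * palindromes (i * 2)
        ≡⟨ cong₂ (λ a b → palindromes a * b) (trans (cong (_∸ i * 2) (shift i o)) (m+n∸n≡m (1 + suc o * 2) (i * 2))) (palindromes-even i) ⟩
      palindromes (1 + suc o * 2) * 2 ^ i
        ≡⟨ cong (_* 2 ^ i) (palindromes-odd (suc o)) ⟩
      2 * 2 ^ suc o * 2 ^ i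
        ≡⟨ trans (*-assoc 2 (2 ^ suc o) (2 ^ i)) (cong (2 *_) (2^-merge i o)) ⟩
      2 * 2 ^ (suc i + o) ∎) ,
    (begin
      palindromes (1 + (suc i + o) * 2 ∸ (1 + i * 2)) * palindromes (1 + i * 2)
        ≡⟨ cong₂ (λ a b → palindromes a * b)
             (trans (cong (_∸ (1 + i * 2)) (trans (shift i o) (sym (+-suc (suc o * 2) (i * 2))))) (m+n∸n≡m (suc o * 2) (1 + i * 2)))
             (palindromes-odd i) ⟩
      palindromes (suc o * 2) * 2 ^ suc i
        ≡⟨ cong (_* 2 ^ suc i) (palindromes-even (suc o)) ⟩
      2 ^ suc o * 2 ^ suc i
        ≡⟨ solve 2 (λ a b → a :* (con 2 :* b) := con 2 :* (a :* b)) refl (2 ^ suc o) (2 ^ i) ⟩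
      2 * (2 ^ suc o * 2 ^ i)
        ≡⟨ cong (2 *_) (2^-merge i o) ⟩
      2 * 2 ^ (suc i + o) ∎)

-- Symmetric gapped words and the correction term

-- By `achiral-suc` the counts accumulate the palindrome numbers 1, 2, 2, 4, 4 and so on. The added
-- `2` is twice the orbit of the zero word and makes the sums pure multiples of powers of two; the
-- factor `3` is `2 + achiral 0`.
achiral-even : (j : ℕ) → 2 + achiral (j * 2) ≡ 3 * 2 ^ j
achiral-odd : (j : ℕ) → 2 + achiral (1 + j * 2) ≡ 2 * 2 ^ suc j

achiral-even zero = refl
achiral-even (suc j) = begin
  2 + achiral (2 + j * 2)
    ≡⟨ cong (2 +_) (trans (achiral-suc (1 + j * 2)) (+-comm (palindromes (1 + j * 2)) _)) ⟩
  2 + achiral (1 + j * 2) + palindromes (1 + j * 2)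
    ≡⟨ cong₂ _+_ (achiral-odd j) (palindromes-odd j) ⟩
  2 * 2 ^ suc j + 2 ^ suc j
    ≡⟨ solve 1 (λ x → con 2 :* x :+ x := con 3 :* x) refl (2 ^ suc j) ⟩
  3 * 2 ^ suc j ∎

achiral-odd j = begin
  2 + achiral (1 + j * 2)
    ≡⟨ cong (2 +_) (trans (achiral-suc (j * 2)) (+-comm (palindromes (j * 2)) _)) ⟩
  2 + achiral (j * 2) + palindromes (j * 2)
    ≡⟨ cong₂ _+_ (achiral-even j) (palindromes-even j) ⟩
  3 * 2 ^ j + 2 ^ j
    ≡⟨ solve 1 (λ x → con 3 :* x :+ x := con 2 :* (con 2 :* x)) refl (2 ^ j) ⟩
  2 * 2 ^ suc j ∎

[r+j*d]/d≡j : (r j d : ℕ) .{{_ : NonZero d}} → r < d → (r + j * d) / d ≡ j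
[r+j*d]/d≡j r j d r<d = trans (+-distrib-/-∣ʳ r (n∣m*n j)) (cong₂ _+_ (m<n⇒m/n≡0 r<d) (m*n/n≡m j d))

correction-0 : (n : ℕ) → n % 4 ≡ 0 → correction n ≡ 3 * 2 ^ ((n ∸ 4) / 4)
correction-0 n e rewrite e = refl

correction-1 : (n : ℕ) → n % 4 ≡ 1 → correction n ≡ 3 * 2 ^ ((n ∸ 4) / 4)
correction-1 n e rewrite e = refl

correction-2 : (n : ℕ) → n % 4 ≡ 2 → correction n ≡ 2 ^ ((n + 2) / 4)
correction-2 n e rewrite e = refl

correction-3 : (n : ℕ) → n % 4 ≡ 3 → correction n ≡ 2 ^ ((n + 2) / 4)
correction-3 n e rewrite e = refl

even⊎odd : (n : ℕ) → ∃ λ t → n ≡ t * 2 ⊎ n ≡ 1 + t * 2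
even⊎odd zero = 0 , inj₁ refl
even⊎odd (suc n) with even⊎odd n
... | t , inj₁ refl = t , inj₂ refl
... | t , inj₂ refl = suc t , inj₁ refl

correction-even : (t : ℕ) → 1 ≤ t → 2 * correction (t * 2) ≡ 2 + achiral t
correction-even t 1≤t with even⊎odd t
-- For `t` equal to `0` the truncated `n ∸ 4` would give the value `3`, and the equation would fail.
correction-even _ () | zero , inj₁ refl
... | suc j , inj₁ refl = trans (cong (2 *_) (begin
  correction (suc j * 2 * 2)            ≡⟨ correction-0 (suc j * 2 * 2) (trans (cong (_% 4) (*-assoc (suc j) 2 2)) (m*n%n≡0 (suc j) 4)) ⟩
  3 * 2 ^ ((j * 2 * 2) / 4)             ≡⟨ cong (λ k → 3 * 2 ^ (k / 4)) (*-assoc j 2 2) ⟩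
  3 * 2 ^ ((j * 4) / 4)                 ≡⟨ cong (λ k → 3 * 2 ^ k) (m*n/n≡m j 4) ⟩
  3 * 2 ^ j                             ∎))
  (trans (solve 1 (λ x → con 2 :* (con 3 :* x) := con 3 :* (con 2 :* x)) refl (2 ^ j)) (sym (achiral-even (suc j))))
... | j , inj₂ refl = trans (cong (2 *_) (begin
  correction (2 + j * 2 * 2)            ≡⟨ correction-2 (2 + j * 2 * 2) (trans (cong (λ k → (2 + k) % 4) (*-assoc j 2 2)) ([m+kn]%n≡m%n 2 j 4)) ⟩
  2 ^ ((2 + j * 2 * 2 + 2) / 4)         ≡⟨ cong (λ k → 2 ^ (k / 4)) (solve 1 (λ j → con 2 :+ j :* con 2 :* con 2 :+ con 2 := (con 1 :+ j) :* con 4) refl j) ⟩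
  2 ^ ((suc j * 4) / 4)                 ≡⟨ cong (2 ^_) (m*n/n≡m (suc j) 4) ⟩
  2 ^ suc j                             ∎)) (sym (achiral-odd j))

correction-odd : (t : ℕ) → 1 ≤ t → 2 * correction (1 + t * 2) ≡ 2 + achiral t
correction-odd t 1≤t with even⊎odd t
correction-odd _ () | zero , inj₁ refl
... | suc j , inj₁ refl = trans (cong (2 *_) (begin
  correction (1 + suc j * 2 * 2)        ≡⟨ correction-1 (1 + suc j * 2 * 2) (trans (cong (λ k → (1 + k) % 4) (*-assoc (suc j) 2 2)) ([m+kn]%n≡m%n 1 (suc j) 4)) ⟩
  3 * 2 ^ ((1 + j * 2 * 2) / 4)         ≡⟨ cong (λ k → 3 * 2 ^ ((1 + k) / 4)) (*-assoc j 2 2) ⟩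
  3 * 2 ^ ((1 + j * 4) / 4)             ≡⟨ cong (λ k → 3 * 2 ^ k) ([r+j*d]/d≡j 1 j 4 (s≤s (s≤s z≤n))) ⟩
  3 * 2 ^ j                             ∎))
  (trans (solve 1 (λ x → con 2 :* (con 3 :* x) := con 3 :* (con 2 :* x)) refl (2 ^ j)) (sym (achiral-even (suc j))))
... | j , inj₂ refl = trans (cong (2 *_) (begin
  correction (3 + j * 2 * 2)            ≡⟨ correction-3 (3 + j * 2 * 2) (trans (cong (λ k → (3 + k) % 4) (*-assoc j 2 2)) ([m+kn]%n≡m%n 3 j 4)) ⟩
  2 ^ ((3 + j * 2 * 2 + 2) / 4)         ≡⟨ cong (λ k → 2 ^ (k / 4)) (solve 1 (λ j → con 3 :+ j :* con 2 :* con 2 :+ con 2 := con 1 :+ (con 1 :+ j) :* con 4) refl j) ⟩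
  2 ^ ((1 + suc j * 4) / 4)             ≡⟨ cong (2 ^_) ([r+j*d]/d≡j 1 (suc j) 4 (s≤s (s≤s z≤n))) ⟩
  2 ^ suc j                             ∎)) (sym (achiral-odd j))

-- Assembling the formula

-- Collects what depends on the parity of `n`, so that the final count is uniform. The reflection
-- total is split so as to exhibit the `2 ^ t` that is going to cancel.
record Half (n : ℕ) : Set where
  field
    m t : ℕ
    t≤1+m : t ≤ suc m
    m≤t : m ≤ t
    n≡ : suc m + t ≡ n
    reflections≡ : reflections n ≡ n * (2 ^ t + 2 * 2 ^ ((n ∸ 3) / 2))
    correction≡ : 2 * correction n ≡ 2 + achiral t

half : (n : ℕ) → 3 ≤ n → Half n
half n 3≤n with even⊎odd n
half _ (s≤s (s≤s ())) | 1 , inj₁ refl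
... | suc (suc j) , inj₁ refl = record
  { m = suc j
  ; t = suc (suc j)
  ; t≤1+m = ≤-refl
  ; m≤t = n≤1+n _
  ; n≡ = solve 1 (λ t → t :+ t := t :* con 2) refl (suc (suc j))
  ; reflections≡ = begin
      reflections (suc (suc j) * 2)
        ≡⟨ reflections-even (suc (suc j)) ⟩
      suc (suc j) * (2 ^ suc (suc j) + 2 * 2 ^ suc (suc j))
        ≡⟨ solve 2 (λ t x → t :* (con 2 :* (con 2 :* x) :+ con 2 :* (con 2 :* (con 2 :* x))) :=
                            t :* con 2 :* (con 2 :* (con 2 :* x) :+ con 2 :* x)) refl (suc (suc j)) (2 ^ j) ⟩
      suc (suc j) * 2 * (2 ^ suc (suc j) + 2 * 2 ^ j)
        ≡⟨ cong (λ k → suc (suc j) * 2 * (2 ^ suc (suc j) + 2 * 2 ^ k)) ([r+j*d]/d≡j 1 j 2 ≤-refl) ⟨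
      suc (suc j) * 2 * (2 ^ suc (suc j) + 2 * 2 ^ ((1 + j * 2) / 2)) ∎
  ; correction≡ = correction-even (suc (suc j)) (s≤s z≤n)
  }
half _ (s≤s ()) | 0 , inj₂ refl
... | suc j , inj₂ refl = record
  { m = suc j
  ; t = suc j
  ; t≤1+m = n≤1+n _
  ; m≤t = ≤-refl
  ; n≡ = solve 1 (λ t → con 1 :+ t :+ t := con 1 :+ t :* con 2) refl (suc j)
  ; reflections≡ = begin
      reflections (1 + suc j * 2)
        ≡⟨ reflections-odd (suc j) ⟩
      (1 + suc j * 2) * (2 * 2 ^ suc j)
        ≡⟨ cong ((1 + suc j * 2) *_) (solve 1 (λ x → con 2 :* x := x :+ x) refl (2 ^ suc j)) ⟩
      (1 + suc j * 2) * (2 ^ suc j + 2 * 2 ^ j)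
        ≡⟨ cong (λ k → (1 + suc j * 2) * (2 ^ suc j + 2 * 2 ^ k)) (m*n/n≡m j 2) ⟨
      (1 + suc j * 2) * (2 ^ suc j + 2 * 2 ^ ((j * 2) / 2)) ∎
  ; correction≡ = correction-odd (suc j) (s≤s z≤n)
  }

-- Here `x` stands for `2 ^ t`, shared by the reflections and the gapped words. Cancelling `n * x`
-- and then the factor `2` replaces the subtractions of the formula.
count-from-double : (n l c s x y a : ℕ) → 2 * c ≡ 2 + a →
  2 * s + n * (x + 2 * y) ≡ l * (2 * n) + (x + a) * n + 2 * n → n * l + n * c ≡ s + n * y
count-from-double n l c s x y a 2c≡ e = *-cancelˡ-≡ _ _ 2 (+-cancelʳ-≡ (n * x) _ _ (begin
  2 * (n * l + n * c) + n * x
    ≡⟨ solve 4 (λ n l c x → con 2 :* (n :* l :+ n :* c) :+ n :* x := l :* (con 2 :* n) :+ n :* (con 2 :* c) :+ n :* x) refl n l c x ⟩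
  l * (2 * n) + n * (2 * c) + n * x
    ≡⟨ cong (λ z → l * (2 * n) + n * z + n * x) 2c≡ ⟩
  l * (2 * n) + n * (2 + a) + n * x
    ≡⟨ solve 4 (λ n l a x → l :* (con 2 :* n) :+ n :* (con 2 :+ a) :+ n :* x := l :* (con 2 :* n) :+ (x :+ a) :* n :+ con 2 :* n) refl n l a x ⟩
  l * (2 * n) + (x + a) * n + 2 * n
    ≡⟨ e ⟨
  2 * s + n * (x + 2 * y)
    ≡⟨ solve 4 (λ n s x y → con 2 :* s :+ n :* (x :+ con 2 :* y) := con 2 :* (s :+ n :* y) :+ n :* x) refl n s x y ⟩
  2 * (s + n * y) + n * x ∎))

theorem1p6 : (n : ℕ) → 3 ≤ n →
    (∃ λ L → IsRepSystem n L) ×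
    (∀ L → IsRepSystem n L →
    n * length L + n * correction n ≡ necklaceSum n + n * 2 ^ ((n ∸ 3) / 2))
theorem1p6 n 3≤n = repSystem n , count (half n 3≤n)
  where
  count : Half n → ∀ L → IsRepSystem n L →
    n * length L + n * correction n ≡ necklaceSum n + n * 2 ^ ((n ∸ 3) / 2)
  count record { m = m ; t = t ; t≤1+m = t≤1+m ; m≤t = m≤t ; n≡ = refl
               ; reflections≡ = reflections≡ ; correction≡ = correction≡ } L L-rep =
    count-from-double n (length L) (correction n) (necklaceSum n) (2 ^ t) (2 ^ ((n ∸ 3) / 2)) (achiral t) correction≡
      (begin
        2 * necklaceSum n + n * (2 ^ t + 2 * 2 ^ ((n ∸ 3) / 2))
          ≡⟨ cong₂ _+_ (necklaceSum-gcd n) (sym reflections≡) ⟩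
        ∑ (upTo n) (λ k → 2 ^ gcd k n) + reflections n
          ≡⟨ Halves.burnside m t t≤1+m m≤t L L-rep ⟩
        length L * (2 * n) + (2 ^ t + achiral t) * n + 2 * n ∎)
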